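{- For every sequence $\mathbf{x}=\{x_k\}_{k\geq 1}$ of points in the unit circle $\mathbb{T}=\mathbb{R}/\mathbb{Z}$, the inequality $d_n(\mathbf{x})\leq \phi_{n-1}$ holds for infinitely many integers $n\geq 2$, where $d_n(\mathbf{x})=\min_{1\leq r<s\leq n}\rho(x_r,x_s)$ for $n\geq 2$ and $\phi_m=\frac{\ln(m+1)-\ln m}{2\ln 2}$ for $m\geq 1$.
   Context: $\mathbb{T}=\mathbb{R}/\mathbb{Z}$ is the unit circle with its standard metric $\rho(s,t)=\mathrm{dist}(s-t,\mathbb{Z})$, i.e. the distance from (any real representative of) $s-t$ to the nearest integer. Sequences are indexed by the integers $k\geq 1$; the terms of the sequence are not assumed to be distinct. -}

module Defs where

open import Data.Nat.Base as ℕ using (ℕ; zero; suc)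
import Data.Nat.Properties as ℕₚ
open import Data.Nat.Coprimality as Coprimality using (1-coprimeTo)
open import Data.Integer.Base as ℤ using (ℤ; +_)
import Data.Integer.Properties as ℤₚ
import Data.Integer.DivMod as ℤDM
open import Data.Rational.Base as ℚ
  using (ℚ; mkℚ; 0ℚ; 1ℚ; ½; _+_; _-_; _*_; -_; _⊓_; ∣_∣; _≤_; _<_; _/_; 1/_; floor; ceiling; *≤*; *<*; ↥_; ↧_; ↧ₙ_)
import Data.Rational.Properties as ℚₚ
open import Data.Rational.Solver using (module +-*-Solver)
open import Data.List.Base using (List; map; concatMap; foldr; applyUpTo)
open import Data.Product.Base using (_×_; _,_; ∃; proj₁; proj₂; Σ-syntax; ∃-syntax)
open import Data.Sum.Base using (inj₁; inj₂)
open import Level using (0ℓ)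
open import Relation.Nullary.Negation.Core using (contradiction)
open import Relation.Binary.Bundles using (Setoid)
open import Relation.Binary.PropositionalEquality.Core
  using (_≡_; _≢_; refl; sym; trans; cong; cong₂; subst; subst₂)

open +-*-Solver

-- Opaque so that unification does not unfold rational arithmetic.
opaque
  fromℤ : ℤ → ℚ
  fromℤ k = mkℚ k 0 (Coprimality.sym (1-coprimeTo ℤ.∣ k ∣))

fromℕ : ℕ → ℚ
fromℕ n = fromℤ (+ n)

-- Reciprocal extended by recip 0 = 0.  It is only relevant at nonzero
-- arguments: it is applied termwise to sequences that are eventually
-- bounded away from 0.
opaque
  recip : ℚ → ℚ
  recip   (mkℚ (+ zero)   _ _) = 0ℚ
  recip q@(mkℚ ℤ.+[1+ _ ] _ _) = 1/ q
  recip q@(mkℚ ℤ.-[1+ _ ] _ _) = 1/ q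

sumℚ : ℕ → (ℕ → ℚ) → ℚ
sumℚ zero    f = 0ℚ
sumℚ (suc n) f = f 0 + sumℚ n (λ j → f (suc j))

-- The distance from q to the nearest integer; see distℤ-≤ and distℤ-attained.
distℤ : ℚ → ℚ
distℤ q = (q - fromℤ (floor q)) ⊓ (fromℤ (ceiling q) - q)

step : ℚ → ℕ → ℚ
step y N = (y - 1ℚ) * recip (fromℕ N)

-- The left Riemann sum of ∫₁^y dt/t with N subintervals of equal length.
riemann : ℚ → ℕ → ℚ
riemann y N = sumℚ N (λ j → step y N * recip (1ℚ + fromℕ j * step y N))

≤-by : ∀ {p q p′ q′} → p ≡ p′ → q ≡ q′ → p ≤ q → p′ ≤ q′
≤-by = subst₂ _≤_

0≤1 : 0ℚ ≤ 1ℚ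
0≤1 = *≤* (ℤ.+≤+ ℕ.z≤n)

0<1 : 0ℚ < 1ℚ
0<1 = *<* (ℤ.+<+ (ℕ.s≤s ℕ.z≤n))

0<½ : 0ℚ < ½
0<½ = *<* (ℤ.+<+ (ℕ.s≤s ℕ.z≤n))

0≤+ : ∀ {p q} → 0ℚ ≤ p → 0ℚ ≤ q → 0ℚ ≤ p + q
0≤+ = ℚₚ.+-mono-≤

0≤* : ∀ {p q} → 0ℚ ≤ p → 0ℚ ≤ q → 0ℚ ≤ p * q
0≤* {p} {q} 0≤p 0≤q =
  ≤-by (ℚₚ.*-zeroʳ p) refl (ℚₚ.*-monoˡ-≤-nonNeg p {{ℚ.nonNegative 0≤p}} 0≤q)

0<* : ∀ {p q} → 0ℚ < p → 0ℚ < q → 0ℚ < p * q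
0<* {p} {q} 0<p 0<q =
  subst (_< p * q) (ℚₚ.*-zeroʳ p) (ℚₚ.*-monoʳ-<-pos p {{ℚ.positive 0<p}} 0<q)

*-mono-≤ : ∀ {p q r s} → 0ℚ ≤ p → 0ℚ ≤ s → p ≤ q → r ≤ s → p * r ≤ q * s
*-mono-≤ {p} {q} {r} {s} 0≤p 0≤s p≤q r≤s = ℚₚ.≤-trans
  (ℚₚ.*-monoˡ-≤-nonNeg p {{ℚ.nonNegative 0≤p}} r≤s)
  (ℚₚ.*-monoʳ-≤-nonNeg s {{ℚ.nonNegative 0≤s}} p≤q)

p≤p+q : ∀ p {q} → 0ℚ ≤ q → p ≤ p + q
p≤p+q p 0≤q = ≤-by (ℚₚ.+-identityʳ p) refl (ℚₚ.+-monoʳ-≤ p 0≤q)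

q≤p+q : ∀ {p} q → 0ℚ ≤ p → q ≤ p + q
q≤p+q q 0≤p = ≤-by (ℚₚ.+-identityˡ q) refl (ℚₚ.+-monoˡ-≤ q 0≤p)

p≤∣p∣ : ∀ p → p ≤ ∣ p ∣
p≤∣p∣ p with ℚₚ.≤-total 0ℚ p
... | inj₁ 0≤p = ℚₚ.≤-reflexive (sym (ℚₚ.0≤p⇒∣p∣≡p 0≤p))
... | inj₂ p≤0 = ℚₚ.≤-trans p≤0 (ℚₚ.0≤∣p∣ p)

∣-∣-sym : ∀ p q → ∣ p - q ∣ ≡ ∣ q - p ∣
∣-∣-sym p q = trans
  (cong ∣_∣ (solve 2 (λ p q → p :- q := :- (q :- p)) refl p q)) (ℚₚ.∣-p∣≡∣p∣ (q - p))

∣p-p∣ : ∀ p → ∣ p - p ∣ ≡ 0ℚ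
∣p-p∣ p = cong ∣_∣ (ℚₚ.+-inverseʳ p)

∣-∣-triangle : ∀ p q r → ∣ p - r ∣ ≤ ∣ p - q ∣ + ∣ q - r ∣
∣-∣-triangle p q r = ≤-by
  (cong ∣_∣ (solve 3 (λ p q r → (p :- q) :+ (q :- r) := p :- r) refl p q r)) refl
  (ℚₚ.∣p+q∣≤∣p∣+∣q∣ (p - q) (q - r))

p≤q+∣p-q∣ : ∀ p q → p ≤ q + ∣ p - q ∣
p≤q+∣p-q∣ p q = ≤-by (solve 2 (λ p q → q :+ (p :- q) := p) refl p q) refl
  (ℚₚ.+-monoʳ-≤ q (p≤∣p∣ (p - q)))

p≤q+r⇒p-q≤r : ∀ {p q r} → p ≤ q + r → p - q ≤ r
p≤q+r⇒p-q≤r {p} {q} {r} le = ≤-by refl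
  (solve 2 (λ q r → (q :+ r) :- q := r) refl q r) (ℚₚ.+-monoˡ-≤ (- q) le)

∣-∣-≤ : ∀ {p q e} → p ≤ q + e → q ≤ p + e → ∣ p - q ∣ ≤ e
∣-∣-≤ {p} {q} {e} p≤ q≤ with ℚₚ.∣p∣≡p∨∣p∣≡-p (p - q)
... | inj₁ eq = ≤-by (sym eq) refl (p≤q+r⇒p-q≤r p≤)
... | inj₂ eq = ≤-by
  (sym (trans eq (solve 2 (λ p q → :- (p :- q) := q :- p) refl p q))) refl (p≤q+r⇒p-q≤r q≤)

+-lipschitz : ∀ p q p′ q′ → ∣ (p + q) - (p′ + q′) ∣ ≤ ∣ p - p′ ∣ + ∣ q - q′ ∣
+-lipschitz p q p′ q′ = ≤-by
  (cong ∣_∣ (solve 4 (λ p q p′ q′ → (p :- p′) :+ (q :- q′) := (p :+ q) :- (p′ :+ q′))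
    refl p q p′ q′)) refl
  (ℚₚ.∣p+q∣≤∣p∣+∣q∣ (p - p′) (q - q′))

neg-lipschitz : ∀ p p′ → ∣ (- p) - (- p′) ∣ ≡ ∣ p - p′ ∣
neg-lipschitz p p′ = trans
  (cong ∣_∣ (solve 2 (λ p p′ → (:- p) :- (:- p′) := :- (p :- p′)) refl p p′))
  (ℚₚ.∣-p∣≡∣p∣ (p - p′))

⊓-lipschitz : ∀ p q p′ q′ → ∣ (p ⊓ q) - (p′ ⊓ q′) ∣ ≤ ∣ p - p′ ∣ + ∣ q - q′ ∣
⊓-lipschitz p q p′ q′ = ∣-∣-≤ (half p q p′ q′)
  (≤-by refl (cong (_+_ (p ⊓ q)) (cong₂ _+_ (∣-∣-sym p′ p) (∣-∣-sym q′ q))) (half p′ q′ p q))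
  where
  half : ∀ p q p′ q′ → p ⊓ q ≤ (p′ ⊓ q′) + (∣ p - p′ ∣ + ∣ q - q′ ∣)
  half p q p′ q′ with ℚₚ.⊓-sel p′ q′
  ... | inj₁ eq = ≤-by refl (cong (_+ (∣ p - p′ ∣ + ∣ q - q′ ∣)) (sym eq))
    (ℚₚ.≤-trans (ℚₚ.p⊓q≤p p q) (ℚₚ.≤-trans (p≤q+∣p-q∣ p p′)
      (ℚₚ.+-monoʳ-≤ p′ (p≤p+q ∣ p - p′ ∣ (ℚₚ.0≤∣p∣ (q - q′))))))
  ... | inj₂ eq = ≤-by refl (cong (_+ (∣ p - p′ ∣ + ∣ q - q′ ∣)) (sym eq))
    (ℚₚ.≤-trans (ℚₚ.p⊓q≤q p q) (ℚₚ.≤-trans (p≤q+∣p-q∣ q q′)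
      (ℚₚ.+-monoʳ-≤ q′ (q≤p+q ∣ q - q′ ∣ (ℚₚ.0≤∣p∣ (p - p′))))))

*-lipschitz : ∀ {B C} p q p′ q′ → ∣ p ∣ ≤ B → ∣ q′ ∣ ≤ C →
              ∣ p * q - p′ * q′ ∣ ≤ B * ∣ q - q′ ∣ + C * ∣ p - p′ ∣
*-lipschitz {B} {C} p q p′ q′ p≤B q′≤C = ≤-by (cong ∣_∣ split) refl
  (ℚₚ.≤-trans (ℚₚ.∣p+q∣≤∣p∣+∣q∣ (p * (q - q′)) (q′ * (p - p′)))
    (ℚₚ.+-mono-≤ (scale p (q - q′) p≤B) (scale q′ (p - p′) q′≤C)))
  where
  split : p * (q - q′) + q′ * (p - p′) ≡ p * q - p′ * q′
  split = solve 4 (λ p q p′ q′ → p :* (q :- q′) :+ q′ :* (p :- p′) := p :* q :- p′ :* q′)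
    refl p q p′ q′
  scale : ∀ {D} p q → ∣ p ∣ ≤ D → ∣ p * q ∣ ≤ D * ∣ q ∣
  scale p q le = ≤-by (sym (ℚₚ.∣p*q∣≡∣p∣*∣q∣ p q)) refl
    (ℚₚ.*-monoʳ-≤-nonNeg ∣ q ∣ {{ℚₚ.∣-∣-nonNeg q}} le)

opaque
  unfolding fromℤ

  fromℤ≡/1 : ∀ k → fromℤ k ≡ k / 1
  fromℤ≡/1 k = sym (ℚₚ.↥p/↧p≡p (fromℤ k))

  fromℤ-+ : ∀ a b → fromℤ (a ℤ.+ b) ≡ fromℤ a + fromℤ b
  fromℤ-+ a b = trans (fromℤ≡/1 (a ℤ.+ b))
    (cong (_/ 1) (sym (cong₂ ℤ._+_ (ℤₚ.*-identityʳ a) (ℤₚ.*-identityʳ b))))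

  fromℤ-neg : ∀ a → fromℤ (ℤ.- a) ≡ - fromℤ a
  fromℤ-neg (+ zero)   = refl
  fromℤ-neg ℤ.+[1+ n ] = refl
  fromℤ-neg ℤ.-[1+ n ] = refl

  fromℤ-mono-≤ : ∀ {a b} → a ℤ.≤ b → fromℤ a ≤ fromℤ b
  fromℤ-mono-≤ a≤b = *≤* (ℤₚ.*-monoʳ-≤-nonNeg (+ 1) a≤b)

  fromℤ-≤⁻ : ∀ {k q} → fromℤ k ≤ q → k ℤ.* ↧ q ℤ.≤ ↥ q ℤ.* + 1
  fromℤ-≤⁻ = ℚₚ.drop-*≤*

  fromℤ-≤⁺ : ∀ {k q} → k ℤ.* ↧ q ℤ.≤ ↥ q ℤ.* + 1 → fromℤ k ≤ q
  fromℤ-≤⁺ = *≤*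

  fromℕ-0 : fromℕ 0 ≡ 0ℚ
  fromℕ-0 = refl

  fromℕ-1 : fromℕ 1 ≡ 1ℚ
  fromℕ-1 = refl

fromℕ-+ : ∀ m n → fromℕ (m ℕ.+ n) ≡ fromℕ m + fromℕ n
fromℕ-+ m n = fromℤ-+ (+ m) (+ n)

fromℕ-suc : ∀ n → fromℕ (suc n) ≡ 1ℚ + fromℕ n
fromℕ-suc n = trans (fromℕ-+ 1 n) (cong (ℚ._+ fromℕ n) fromℕ-1)

fromℕ-* : ∀ m n → fromℕ (m ℕ.* n) ≡ fromℕ m * fromℕ n
fromℕ-* zero    n = trans fromℕ-0 (sym (trans (cong (_* fromℕ n) fromℕ-0) (ℚₚ.*-zeroˡ (fromℕ n))))
fromℕ-* (suc m) n = trans (fromℕ-+ n (m ℕ.* n)) (trans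
  (cong (_+_ (fromℕ n)) (fromℕ-* m n))
  (trans (solve 2 (λ a b → b :+ a :* b := (con 1ℚ :+ a) :* b) refl (fromℕ m) (fromℕ n))
    (cong (_* fromℕ n) (sym (fromℕ-suc m)))))

fromℕ-mono-≤ : ∀ {m n} → m ℕ.≤ n → fromℕ m ≤ fromℕ n
fromℕ-mono-≤ m≤n = fromℤ-mono-≤ (ℤ.+≤+ m≤n)

0≤fromℕ : ∀ n → 0ℚ ≤ fromℕ n
0≤fromℕ n = ≤-by fromℕ-0 refl (fromℕ-mono-≤ {0} {n} ℕ.z≤n)

1≤fromℕ : ∀ {n} → 1 ℕ.≤ n → 1ℚ ≤ fromℕ n
1≤fromℕ 1≤n = ≤-by fromℕ-1 refl (fromℕ-mono-≤ 1≤n)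

0<fromℕ : ∀ {n} → 1 ℕ.≤ n → 0ℚ < fromℕ n
0<fromℕ 1≤n = ℚₚ.<-≤-trans 0<1 (1≤fromℕ 1≤n)

floor≤ : ∀ q → fromℤ (floor q) ≤ q
floor≤ q@(mkℚ a d _) = fromℤ-≤⁺ (ℤₚ.≤-trans (ℤDM.[n/d]*d≤n a (+ suc d)) (ℤₚ.≤-reflexive (sym (ℤₚ.*-identityʳ a))))

floor-max : ∀ k q → fromℤ k ≤ q → k ℤ.≤ floor q
floor-max k q@(mkℚ a d _) k≤q = ℤₚ.≮⇒≥ λ lt →
  ℤₚ.<-irrefl refl (ℤₚ.<-≤-trans a<
    (ℤₚ.≤-trans (ℤₚ.*-monoʳ-≤-nonNeg (+ suc d) (ℤₚ.i<j⇒suc[i]≤j lt)) kd≤a))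
  where
  kd≤a : k ℤ.* + suc d ℤ.≤ a
  kd≤a = ℤₚ.≤-trans (fromℤ-≤⁻ k≤q) (ℤₚ.≤-reflexive (ℤₚ.*-identityʳ a))
  a< : a ℤ.< ℤ.suc (floor q) ℤ.* + suc d
  a< = subst (λ z → a ℤ.< ℤ.suc z ℤ.* + suc d) (sym (ℤDM.div-pos-is-/ℕ a (suc d)))
         (ℤDM.n<s[n/ℕd]*d a (suc d))

≤ceiling : ∀ q → q ≤ fromℤ (ceiling q)
≤ceiling q@record{} = ≤-by (solve 1 (λ q → :- (:- q) := q) refl q)
  (sym (fromℤ-neg (floor (- q)))) (ℚₚ.neg-antimono-≤ (floor≤ (- q)))

ceiling-min : ∀ k q → q ≤ fromℤ k → ceiling q ℤ.≤ k
ceiling-min k q@record{} q≤k = subst (ceiling q ℤ.≤_) (ℤₚ.neg-involutive k)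
  (ℤₚ.neg-mono-≤ (floor-max (ℤ.- k) (- q)
    (≤-by (sym (fromℤ-neg k)) refl (ℚₚ.neg-antimono-≤ q≤k))))

distℤ-≤ : ∀ q k → distℤ q ≤ ∣ q - fromℤ k ∣
distℤ-≤ q k with ℚₚ.≤-total (fromℤ k) q
... | inj₁ k≤q = ℚₚ.≤-trans (ℚₚ.p⊓q≤p _ (fromℤ (ceiling q) - q)) (ℚₚ.≤-trans
  (ℚₚ.+-monoʳ-≤ q (ℚₚ.neg-antimono-≤ (fromℤ-mono-≤ (floor-max k q k≤q))))
  (p≤∣p∣ (q - fromℤ k)))
... | inj₂ q≤k = ℚₚ.≤-trans (ℚₚ.p⊓q≤q (q - fromℤ (floor q)) _) (ℚₚ.≤-trans
  (ℚₚ.+-monoˡ-≤ (- q) (fromℤ-mono-≤ (ceiling-min k q q≤k)))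
  (≤-by refl (∣-∣-sym (fromℤ k) q) (p≤∣p∣ (fromℤ k - q))))

0≤q-p : ∀ {p q} → p ≤ q → 0ℚ ≤ q - p
0≤q-p {p} {q} p≤q = ≤-by (ℚₚ.+-inverseʳ p) refl (ℚₚ.+-monoˡ-≤ (- p) p≤q)

distℤ-attained : ∀ q → ∃[ k ] distℤ q ≡ ∣ q - fromℤ k ∣
distℤ-attained q with ℚₚ.⊓-sel (q - fromℤ (floor q)) (fromℤ (ceiling q) - q)
... | inj₁ eq = floor q , trans eq (sym (ℚₚ.0≤p⇒∣p∣≡p (0≤q-p (floor≤ q))))
... | inj₂ eq = ceiling q , trans eq (trans (sym (ℚₚ.0≤p⇒∣p∣≡p (0≤q-p (≤ceiling q))))
  (∣-∣-sym (fromℤ (ceiling q)) q))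

distℤ-lipschitz : ∀ p q → ∣ distℤ p - distℤ q ∣ ≤ ∣ p - q ∣
distℤ-lipschitz p q = ∣-∣-≤ (half p q)
  (≤-by refl (cong (_+_ (distℤ p)) (∣-∣-sym q p)) (half q p))
  where
  half : ∀ p q → distℤ p ≤ distℤ q + ∣ p - q ∣
  half p q with distℤ-attained q
  ... | k , eq = ℚₚ.≤-trans (distℤ-≤ p k) (ℚₚ.≤-trans (∣-∣-triangle p q (fromℤ k))
    (≤-by refl (trans (ℚₚ.+-comm ∣ p - q ∣ _) (cong (_+ ∣ p - q ∣) (sym eq))) ℚₚ.≤-refl))

distℤ-shift : ∀ p k → distℤ (p + fromℤ k) ≡ distℤ p
distℤ-shift p k = ℚₚ.≤-antisym le ge
  where
  le : distℤ (p + fromℤ k) ≤ distℤ p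
  le with distℤ-attained p
  ... | j , eq = ≤-by refl
    (trans (cong (λ z → ∣ (p + fromℤ k) - z ∣) (fromℤ-+ j k))
      (trans (cong ∣_∣ (solve 3 (λ p j k → (p :+ k) :- (j :+ k) := p :- j) refl p (fromℤ j) (fromℤ k)))
        (sym eq)))
    (distℤ-≤ (p + fromℤ k) (j ℤ.+ k))
  ge : distℤ p ≤ distℤ (p + fromℤ k)
  ge with distℤ-attained (p + fromℤ k)
  ... | j , eq = ≤-by refl
    (trans (cong (λ z → ∣ p - z ∣) (trans (fromℤ-+ j (ℤ.- k)) (cong (_+_ (fromℤ j)) (fromℤ-neg k))))
      (trans (cong ∣_∣ (solve 3 (λ p j k → p :- (j :- k) := (p :+ k) :- j) refl p (fromℤ j) (fromℤ k)))
        (sym eq)))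
    (distℤ-≤ p (j ℤ.+ ℤ.- k))

≮0 : ∀ {q} → 0ℚ < q → ↥ q ≢ + 0
≮0 {q} 0<q q≡0 = ℚₚ.<⇒≢ 0<q (sym (ℚₚ.↥p≡0⇒p≡0 q q≡0))

opaque
  unfolding recip

  recip-inverseʳ : ∀ {q} → 0ℚ < q → q * recip q ≡ 1ℚ
  recip-inverseʳ   {mkℚ (+ zero) _ _} 0<q = contradiction refl (≮0 0<q)
  recip-inverseʳ {q@(mkℚ ℤ.+[1+ _ ] _ _)} _ = ℚₚ.*-inverseʳ q
  recip-inverseʳ {q@(mkℚ ℤ.-[1+ _ ] _ _)} _ = ℚₚ.*-inverseʳ q

  recip-pos : ∀ {q} → 0ℚ < q → 0ℚ < recip q
  recip-pos   {mkℚ (+ zero) _ _} 0<q = contradiction refl (≮0 0<q)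
  recip-pos {q@(mkℚ ℤ.+[1+ _ ] _ _)} _ = ℚₚ.positive⁻¹ (1/ q)
  recip-pos {mkℚ ℤ.-[1+ _ ] _ _} (*<* ())

0≤recip : ∀ {q} → 0ℚ < q → 0ℚ ≤ recip q
0≤recip 0<q = ℚₚ.<⇒≤ (recip-pos 0<q)

recip-unique : ∀ {p q} → 0ℚ < p → p * q ≡ 1ℚ → q ≡ recip p
recip-unique {p} {q} 0<p pq≡1 = trans (sym (ℚₚ.*-identityʳ q)) (trans
  (cong (q *_) (sym (recip-inverseʳ 0<p))) (trans
  (solve 3 (λ p q r → q :* (p :* r) := (p :* q) :* r) refl p q (recip p)) (trans
  (cong (_* recip p) pq≡1) (ℚₚ.*-identityˡ (recip p)))))

recip-anti : ∀ {p q} → 0ℚ < p → p ≤ q → recip q ≤ recip p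
recip-anti {p} {q} 0<p p≤q = ≤-by
  (trans (cong (recip q *_) (recip-inverseʳ 0<p)) (ℚₚ.*-identityʳ _))
  (trans (solve 3 (λ q r s → r :* (q :* s) := (q :* r) :* s) refl q (recip q) (recip p))
    (trans (cong (_* recip p) (recip-inverseʳ 0<q)) (ℚₚ.*-identityˡ _)))
  (ℚₚ.*-monoˡ-≤-nonNeg (recip q) {{ℚ.nonNegative (0≤recip 0<q)}}
    (ℚₚ.*-monoʳ-≤-nonNeg (recip p) {{ℚ.nonNegative (0≤recip 0<p)}} p≤q))
  where 0<q = ℚₚ.<-≤-trans 0<p p≤q

∣*recip*recip∣ : ∀ {δ p q} r → 0ℚ < δ → δ ≤ p → δ ≤ q →
                 ∣ r * (recip p * recip q) ∣ ≤ ∣ r ∣ * (recip δ * recip δ)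
∣*recip*recip∣ {δ} {p} {q} r 0<δ δ≤p δ≤q = ≤-by (sym (ℚₚ.∣p*q∣≡∣p∣*∣q∣ r _)) refl
  (ℚₚ.*-monoˡ-≤-nonNeg ∣ r ∣ {{ℚₚ.∣-∣-nonNeg r}}
    (≤-by (sym (ℚₚ.0≤p⇒∣p∣≡p (0≤* 0≤p⁻¹ 0≤q⁻¹))) refl
      (*-mono-≤ 0≤p⁻¹ (0≤recip 0<δ) (recip-anti 0<δ δ≤p) (recip-anti 0<δ δ≤q))))
  where
  0≤p⁻¹ = 0≤recip (ℚₚ.<-≤-trans 0<δ δ≤p)
  0≤q⁻¹ = 0≤recip (ℚₚ.<-≤-trans 0<δ δ≤q)

recip-lipschitz : ∀ {δ p q} → 0ℚ < δ → δ ≤ p → δ ≤ q →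
                  ∣ recip p - recip q ∣ ≤ ∣ p - q ∣ * (recip δ * recip δ)
recip-lipschitz {δ} {p} {q} 0<δ δ≤p δ≤q = ≤-by
  (cong ∣_∣ (sym (trans
    (cong₂ _-_ (trans (sym (ℚₚ.*-identityʳ (recip p))) (cong (recip p *_) (sym (recip-inverseʳ 0<q))))
               (trans (sym (ℚₚ.*-identityʳ (recip q))) (cong (recip q *_) (sym (recip-inverseʳ 0<p)))))
    (solve 4 (λ p q r s → r :* (q :* s) :- s :* (p :* r) := (q :- p) :* (r :* s))
      refl p q (recip p) (recip q)))))
  (cong (_* (recip δ * recip δ)) (∣-∣-sym q p))
  (∣*recip*recip∣ (q - p) 0<δ δ≤p δ≤q)
  where
  0<p = ℚₚ.<-≤-trans 0<δ δ≤p
  0<q = ℚₚ.<-≤-trans 0<δ δ≤q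

sumℚ-cong : ∀ n {f g} → (∀ j → f j ≡ g j) → sumℚ n f ≡ sumℚ n g
sumℚ-cong zero    eq = refl
sumℚ-cong (suc n) eq = cong₂ _+_ (eq 0) (sumℚ-cong n (λ j → eq (suc j)))

sumℚ-const : ∀ n v → sumℚ n (λ _ → v) ≡ fromℕ n * v
sumℚ-const zero    v = sym (trans (cong (_* v) fromℕ-0) (ℚₚ.*-zeroˡ v))
sumℚ-const (suc n) v = trans (cong (_+_ v) (sumℚ-const n v)) (trans
  (solve 2 (λ n v → v :+ n :* v := (con 1ℚ :+ n) :* v) refl (fromℕ n) v)
  (cong (_* v) (sym (fromℕ-suc n))))

sumℚ-+ : ∀ m n f → sumℚ (m ℕ.+ n) f ≡ sumℚ m f + sumℚ n (λ j → f (m ℕ.+ j))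
sumℚ-+ zero    n f = sym (ℚₚ.+-identityˡ _)
sumℚ-+ (suc m) n f = trans (cong (_+_ (f 0)) (sumℚ-+ m n (λ j → f (suc j))))
  (sym (ℚₚ.+-assoc (f 0) _ _))

sumℚ-* : ∀ m n f → sumℚ (m ℕ.* n) f ≡ sumℚ m (λ j → sumℚ n (λ i → f (j ℕ.* n ℕ.+ i)))
sumℚ-* zero    n f = refl
sumℚ-* (suc m) n f = trans (sumℚ-+ n (m ℕ.* n) f) (cong (_+_ (sumℚ n f))
  (trans (sumℚ-* m n (λ j → f (n ℕ.+ j)))
    (sumℚ-cong m (λ j → sumℚ-cong n (λ i → cong f (sym (ℕₚ.+-assoc n (j ℕ.* n) i)))))))

sumℚ-near : ∀ n {f g} e → (∀ j → j ℕ.< n → ∣ f j - g j ∣ ≤ e) →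
            ∣ sumℚ n f - sumℚ n g ∣ ≤ fromℕ n * e
sumℚ-near zero          e near = ≤-by refl (sym (trans (cong (_* e) fromℕ-0) (ℚₚ.*-zeroˡ e))) ℚₚ.≤-refl
sumℚ-near (suc n) {f} {g} e near = ≤-by refl
  (trans (solve 2 (λ n e → e :+ n :* e := (con 1ℚ :+ n) :* e) refl (fromℕ n) e)
    (cong (_* e) (sym (fromℕ-suc n))))
  (ℚₚ.≤-trans (+-lipschitz (f 0) _ (g 0) _)
    (ℚₚ.+-mono-≤ (near 0 (ℕ.s≤s ℕ.z≤n)) (sumℚ-near n e (λ j j<n → near (suc j) (ℕ.s≤s j<n)))))

sumℚ-≥ : ∀ n {f} e → (∀ j → j ℕ.< n → e ≤ f j) → fromℕ n * e ≤ sumℚ n f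
sumℚ-≥ zero        e ge = ≤-by (sym (trans (cong (_* e) fromℕ-0) (ℚₚ.*-zeroˡ e))) refl ℚₚ.≤-refl
sumℚ-≥ (suc n) {f} e ge = ≤-by
  (trans (solve 2 (λ n e → e :+ n :* e := (con 1ℚ :+ n) :* e) refl (fromℕ n) e)
    (cong (_* e) (sym (fromℕ-suc n)))) refl
  (ℚₚ.+-mono-≤ (ge 0 (ℕ.s≤s ℕ.z≤n)) (sumℚ-≥ n e (λ j j<n → ge (suc j) (ℕ.s≤s j<n))))

N*recipN : ∀ {N} → 1 ℕ.≤ N → fromℕ N * recip (fromℕ N) ≡ 1ℚ
N*recipN 1≤N = recip-inverseʳ (0<fromℕ 1≤N)

N*step : ∀ y {N} → 1 ℕ.≤ N → fromℕ N * step y N ≡ y - 1ℚ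
N*step y {N} 1≤N = trans
  (solve 3 (λ n y r → n :* (y :* r) := y :* (n :* r)) refl (fromℕ N) (y - 1ℚ) (recip (fromℕ N)))
  (trans (cong ((y - 1ℚ) *_) (N*recipN 1≤N)) (ℚₚ.*-identityʳ _))

node-≥ : ∀ {δ y} → δ ≤ 1ℚ → δ ≤ y → ∀ {N j} → 1 ℕ.≤ N → j ℕ.≤ N →
         δ ≤ 1ℚ + fromℕ j * step y N
node-≥ {δ} {y} δ≤1 δ≤y {N} {j} 1≤N j≤N = ≤-by
  (solve 2 (λ t d → (con 1ℚ :- t) :* d :+ t :* d := d) refl t δ)
  (trans (solve 2 (λ t y → (con 1ℚ :- t) :* con 1ℚ :+ t :* y := con 1ℚ :+ t :* (y :- con 1ℚ)) refl t y)
    (cong (_+_ 1ℚ) (solve 3 (λ j r y → (j :* r) :* y := j :* (y :* r)) refl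
      (fromℕ j) (recip (fromℕ N)) (y - 1ℚ))))
  (ℚₚ.+-mono-≤
    (ℚₚ.*-monoˡ-≤-nonNeg (1ℚ - t) {{ℚ.nonNegative (0≤q-p t≤1)}} δ≤1)
    (ℚₚ.*-monoˡ-≤-nonNeg t {{ℚ.nonNegative 0≤t}} δ≤y))
  where
  t = fromℕ j * recip (fromℕ N)
  0≤N⁻¹ = 0≤recip (0<fromℕ 1≤N)
  0≤t : 0ℚ ≤ t
  0≤t = 0≤* (0≤fromℕ j) 0≤N⁻¹
  t≤1 : t ≤ 1ℚ
  t≤1 = ≤-by refl (N*recipN 1≤N)
    (ℚₚ.*-monoʳ-≤-nonNeg (recip (fromℕ N)) {{ℚ.nonNegative 0≤N⁻¹}} (fromℕ-mono-≤ j≤N))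

riemann-lipschitz : ∀ {δ y y′ N} → 0ℚ < δ → δ ≤ 1ℚ → δ ≤ y → δ ≤ y′ → 1 ℕ.≤ N →
  ∣ riemann y N - riemann y′ N ∣ ≤ ∣ y - y′ ∣ * (recip δ * recip δ)
riemann-lipschitz {δ} {y} {y′} {N} 0<δ δ≤1 δ≤y δ≤y′ 1≤N = ≤-by refl
  (trans (sym (ℚₚ.*-assoc (fromℕ N) _ _)) (cong (_* (recip δ * recip δ)) N*∣step-step∣))
  (sumℚ-near N _ term)
  where
  h  = step y N
  h′ = step y′ N
  term : ∀ j → j ℕ.< N →
    ∣ h * recip (1ℚ + fromℕ j * h) - h′ * recip (1ℚ + fromℕ j * h′) ∣ ≤ ∣ h - h′ ∣ * (recip δ * recip δ)
  term j j<N = ≤-by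
    (cong ∣_∣ (sym (trans
      (cong₂ _-_ (trans (sym (ℚₚ.*-identityʳ (h * recip p))) (cong ((h * recip p) *_) (sym (recip-inverseʳ (ℚₚ.<-≤-trans 0<δ δ≤p′)))))
                 (trans (sym (ℚₚ.*-identityʳ (h′ * recip p′))) (cong ((h′ * recip p′) *_) (sym (recip-inverseʳ (ℚₚ.<-≤-trans 0<δ δ≤p))))))
      (solve 5 (λ h h′ j r r′ →
          (h :* r) :* ((con 1ℚ :+ j :* h′) :* r′) :- (h′ :* r′) :* ((con 1ℚ :+ j :* h) :* r)
            := (h :- h′) :* (r :* r′))
        refl h h′ (fromℕ j) (recip p) (recip p′)))))
    refl
    (∣*recip*recip∣ (h - h′) 0<δ δ≤p δ≤p′)
    where
    p  = 1ℚ + fromℕ j * h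
    p′ = 1ℚ + fromℕ j * h′
    δ≤p  = node-≥ δ≤1 δ≤y  1≤N (ℕₚ.<⇒≤ j<N)
    δ≤p′ = node-≥ δ≤1 δ≤y′ 1≤N (ℕₚ.<⇒≤ j<N)
  N*∣step-step∣ : fromℕ N * ∣ h - h′ ∣ ≡ ∣ y - y′ ∣
  N*∣step-step∣ = trans
    (trans (cong (_* ∣ h - h′ ∣) (sym (ℚₚ.0≤p⇒∣p∣≡p (0≤fromℕ N)))) (sym (ℚₚ.∣p*q∣≡∣p∣*∣q∣ (fromℕ N) (h - h′))))
    (cong ∣_∣ (trans
      (solve 3 (λ n h h′ → n :* (h :- h′) := n :* h :- n :* h′) refl (fromℕ N) h h′)
      (trans (cong₂ _-_ (N*step y 1≤N) (N*step y′ 1≤N))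
        (solve 2 (λ y y′ → (y :- con 1ℚ) :- (y′ :- con 1ℚ) := y :- y′) refl y y′))))

riemann-refine : ∀ {δ y N M} → 0ℚ < δ → δ ≤ 1ℚ → δ ≤ y → 1 ℕ.≤ N → 1 ℕ.≤ M →
  ∣ riemann y N - riemann y (N ℕ.* M) ∣
    ≤ (∣ y - 1ℚ ∣ * ∣ y - 1ℚ ∣ * (recip δ * recip δ)) * recip (fromℕ N)
riemann-refine {δ} {y} {N} {M} 0<δ δ≤1 δ≤y 1≤N 1≤M = ≤-by
  (cong (λ z → ∣ riemann y N - z ∣) (sym (sumℚ-* N M fine)))
  bound
  (sumℚ-near N _ block)
  where
  h = step y N
  H = step y (N ℕ.* M)
  c = recip δ * recip δ
  1≤NM : 1 ℕ.≤ N ℕ.* M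
  1≤NM = ℕₚ.*-mono-≤ 1≤N 1≤M
  fine : ℕ → ℚ
  fine k = H * recip (1ℚ + fromℕ k * H)
  M*H : fromℕ M * H ≡ h
  M*H = trans (solve 3 (λ m y r → m :* (y :* r) := y :* (m :* r)) refl (fromℕ M) (y - 1ℚ) _)
    (cong ((y - 1ℚ) *_) (recip-unique (0<fromℕ 1≤N)
      (trans (sym (ℚₚ.*-assoc (fromℕ N) (fromℕ M) _))
        (trans (cong (_* recip (fromℕ (N ℕ.* M))) (sym (fromℕ-* N M))) (N*recipN 1≤NM)))))
  e = fromℕ M * (∣ H ∣ * ∣ H ∣ * c)
  term : ∀ j → j ℕ.< N → ∀ i → i ℕ.< M →
         ∣ H * recip (1ℚ + fromℕ j * h) - fine (j ℕ.* M ℕ.+ i) ∣ ≤ e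
  term j j<N i i<M = ≤-by
    (sym (trans (cong ∣_∣ (solve 3 (λ H a b → H :* a :- H :* b := H :* (a :- b)) refl H _ _))
      (ℚₚ.∣p*q∣≡∣p∣*∣q∣ H _)))
    (solve 3 (λ H m c → H :* ((m :* H) :* c) := m :* (H :* H :* c)) refl ∣ H ∣ (fromℕ M) c)
    (ℚₚ.*-monoˡ-≤-nonNeg ∣ H ∣ {{ℚₚ.∣-∣-nonNeg H}} (ℚₚ.≤-trans
      (recip-lipschitz 0<δ (node-≥ δ≤1 δ≤y 1≤N (ℕₚ.<⇒≤ j<N)) (node-≥ δ≤1 δ≤y 1≤NM k≤NM))
      (ℚₚ.*-monoʳ-≤-nonNeg c {{ℚ.nonNegative (0≤* (0≤recip 0<δ) (0≤recip 0<δ))}} nodes)))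
    where
    k = j ℕ.* M ℕ.+ i
    k≤NM : k ℕ.≤ N ℕ.* M
    k≤NM = ℕₚ.≤-trans (ℕₚ.+-monoʳ-≤ (j ℕ.* M) (ℕₚ.<⇒≤ i<M))
      (ℕₚ.≤-trans (ℕₚ.≤-reflexive (ℕₚ.+-comm (j ℕ.* M) M)) (ℕₚ.*-monoˡ-≤ M j<N))
    diff : (1ℚ + fromℕ j * h) - (1ℚ + fromℕ k * H) ≡ - (fromℕ i * H)
    diff = trans
      (cong₂ (λ a b → (1ℚ + fromℕ j * a) - (1ℚ + b * H)) (sym M*H)
        (trans (fromℕ-+ (j ℕ.* M) i) (cong (ℚ._+ fromℕ i) (fromℕ-* j M))))
      (solve 4 (λ j m i H →
          (con 1ℚ :+ j :* (m :* H)) :- (con 1ℚ :+ (j :* m :+ i) :* H) := :- (i :* H))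
        refl (fromℕ j) (fromℕ M) (fromℕ i) H)
    nodes : ∣ (1ℚ + fromℕ j * h) - (1ℚ + fromℕ k * H) ∣ ≤ fromℕ M * ∣ H ∣
    nodes = ≤-by
      (sym (trans (cong ∣_∣ diff) (trans (ℚₚ.∣-p∣≡∣p∣ (fromℕ i * H)) (trans (ℚₚ.∣p*q∣≡∣p∣*∣q∣ (fromℕ i) H)
        (cong (_* ∣ H ∣) (ℚₚ.0≤p⇒∣p∣≡p (0≤fromℕ i)))))))
      refl
      (ℚₚ.*-monoʳ-≤-nonNeg ∣ H ∣ {{ℚₚ.∣-∣-nonNeg H}} (fromℕ-mono-≤ (ℕₚ.<⇒≤ i<M)))
  block : ∀ j → j ℕ.< N →
    ∣ h * recip (1ℚ + fromℕ j * h) - sumℚ M (λ i → fine (j ℕ.* M ℕ.+ i)) ∣ ≤ fromℕ M * e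
  block j j<N = ≤-by
    (cong (λ z → ∣ z - sumℚ M (λ i → fine (j ℕ.* M ℕ.+ i)) ∣)
      (trans (sumℚ-const M _) (trans (sym (ℚₚ.*-assoc (fromℕ M) H _)) (cong (_* recip (1ℚ + fromℕ j * h)) M*H))))
    refl
    (sumℚ-near M e (term j j<N))
  M*∣H∣ : fromℕ M * ∣ H ∣ ≡ ∣ y - 1ℚ ∣ * recip (fromℕ N)
  M*∣H∣ = trans (cong (_* ∣ H ∣) (sym (ℚₚ.0≤p⇒∣p∣≡p (0≤fromℕ M)))) (trans (sym (ℚₚ.∣p*q∣≡∣p∣*∣q∣ (fromℕ M) H))
    (trans (cong ∣_∣ M*H) (trans (ℚₚ.∣p*q∣≡∣p∣*∣q∣ (y - 1ℚ) _)
      (cong (∣ y - 1ℚ ∣ *_) (ℚₚ.0≤p⇒∣p∣≡p (0≤recip (0<fromℕ 1≤N)))))))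
  bound : fromℕ N * (fromℕ M * e) ≡ (∣ y - 1ℚ ∣ * ∣ y - 1ℚ ∣ * c) * recip (fromℕ N)
  bound = trans
    (solve 4 (λ n m H c → n :* (m :* (m :* (H :* H :* c))) := n :* ((m :* H) :* (m :* H)) :* c)
      refl (fromℕ N) (fromℕ M) ∣ H ∣ c)
    (trans (cong (λ z → fromℕ N * (z * z) * c) M*∣H∣)
    (trans (solve 4 (λ n a r c → n :* ((a :* r) :* (a :* r)) :* c := ((a :* a :* c) :* r) :* (n :* r))
        refl (fromℕ N) ∣ y - 1ℚ ∣ (recip (fromℕ N)) c)
      (trans (cong ((∣ y - 1ℚ ∣ * ∣ y - 1ℚ ∣ * c) * recip (fromℕ N) *_) (N*recipN 1≤N)) (ℚₚ.*-identityʳ _))))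

riemann-near : ∀ {δ B y y′ N M} → 0ℚ < δ → δ ≤ 1ℚ → δ ≤ y → δ ≤ y′ →
  ∣ y - 1ℚ ∣ ≤ B → ∣ y′ - 1ℚ ∣ ≤ B → 1 ℕ.≤ N → 1 ℕ.≤ M →
  ∣ riemann y N - riemann y′ M ∣ ≤
    (recip δ * recip δ) * ∣ y - y′ ∣ +
    (B * B * (recip δ * recip δ)) * (recip (fromℕ N) + recip (fromℕ M))
riemann-near {δ} {B} {y} {y′} {N} {M} 0<δ δ≤1 δ≤y δ≤y′ y≤B y′≤B 1≤N 1≤M =
  ℚₚ.≤-trans (∣-∣-triangle (riemann y N) (riemann y (N ℕ.* M)) (riemann y′ M)) (≤-by refl
    (solve 5 (λ c d b r s → b :* r :+ (d :* c :+ b :* s) := c :* d :+ b :* (r :+ s))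
      refl c ∣ y - y′ ∣ (B * B * c) (recip (fromℕ N)) (recip (fromℕ M)))
    (ℚₚ.+-mono-≤ (widen 1≤N 1≤M δ≤y y≤B)
      (ℚₚ.≤-trans (∣-∣-triangle (riemann y (N ℕ.* M)) (riemann y′ (N ℕ.* M)) (riemann y′ M))
        (ℚₚ.+-mono-≤ (riemann-lipschitz 0<δ δ≤1 δ≤y δ≤y′ (ℕₚ.*-mono-≤ 1≤N 1≤M))
          (≤-by (trans (∣-∣-sym (riemann y′ M) (riemann y′ (M ℕ.* N))) (cong (λ n → ∣ riemann y′ n - riemann y′ M ∣) (ℕₚ.*-comm M N))) refl
            (widen 1≤M 1≤N δ≤y′ y′≤B))))))
  where
  c = recip δ * recip δ
  0≤c : 0ℚ ≤ c
  0≤c = 0≤* (0≤recip 0<δ) (0≤recip 0<δ)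
  widen : ∀ {N M y} → 1 ℕ.≤ N → 1 ℕ.≤ M → δ ≤ y → ∣ y - 1ℚ ∣ ≤ B →
          ∣ riemann y N - riemann y (N ℕ.* M) ∣ ≤ (B * B * c) * recip (fromℕ N)
  widen {N} {M} {y} 1≤N 1≤M δ≤y y≤B = ℚₚ.≤-trans (riemann-refine 0<δ δ≤1 δ≤y 1≤N 1≤M)
    (ℚₚ.*-monoʳ-≤-nonNeg (recip (fromℕ N)) {{ℚ.nonNegative (0≤recip (0<fromℕ 1≤N))}}
      (ℚₚ.*-monoʳ-≤-nonNeg c {{ℚ.nonNegative 0≤c}}
        (*-mono-≤ (ℚₚ.0≤∣p∣ (y - 1ℚ)) (ℚₚ.≤-trans (ℚₚ.0≤∣p∣ (y - 1ℚ)) y≤B) y≤B y≤B)))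

Eventually : (ℕ → Set) → Set
Eventually P = ∃[ N ] (∀ n → N ℕ.≤ n → P n)

Small : (ℕ → ℕ → ℚ) → Set
Small E = ∀ ε → 0ℚ < ε → ∃[ N ] (∀ m n → N ℕ.≤ m → N ℕ.≤ n → E m n ≤ ε)

Cauchy : (ℕ → ℚ) → Set
Cauchy s = Small (λ m n → ∣ s m - s n ∣)

record ℝ : Set where
  constructor mkℝ
  field
    seq    : ℕ → ℚ
    cauchy : Cauchy seq

open ℝ public

infix 4 _≤ᴿ_ _≈ᴿ_

_≤ᴿ_ : ℝ → ℝ → Set
x ≤ᴿ y = ∀ ε → 0ℚ < ε → Eventually (λ n → seq x n ≤ seq y n + ε)

_≈ᴿ_ : ℝ → ℝ → Set
x ≈ᴿ y = ∀ ε → 0ℚ < ε → Eventually (λ n → ∣ seq x n - seq y n ∣ ≤ ε)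

Positive : ℝ → Set
Positive x = ∃[ δ ] (0ℚ < δ × Eventually (λ n → δ ≤ seq x n))

both : ∀ {P Q R : ℕ → Set} → (∀ {n} → P n → Q n → R n) →
       Eventually P → Eventually Q → Eventually R
both f (M , p) (N , q) = M ℕ.⊔ N , λ n le →
  f (p n (ℕₚ.≤-trans (ℕₚ.m≤m⊔n M N) le)) (q n (ℕₚ.≤-trans (ℕₚ.m≤n⊔m M N) le))

always : ∀ {P : ℕ → Set} → (∀ n → P n) → Eventually P
always p = 0 , λ n _ → p n

0<½* : ∀ {ε} → 0ℚ < ε → 0ℚ < ½ * ε
0<½* = 0<* 0<½

½+½ : ∀ ε → ½ * ε + ½ * ε ≡ ε
½+½ = solve 1 (λ ε → con ½ :* ε :+ con ½ :* ε := ε) refl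

small-+ : ∀ {E F} → Small E → Small F → Small (λ m n → E m n + F m n)
small-+ e f ε 0<ε with e (½ * ε) (0<½* 0<ε) | f (½ * ε) (0<½* 0<ε)
... | M , p | N , q = M ℕ.⊔ N , λ m n m≥ n≥ → ≤-by refl (½+½ ε) (ℚₚ.+-mono-≤
  (p m n (ℕₚ.≤-trans (ℕₚ.m≤m⊔n M N) m≥) (ℕₚ.≤-trans (ℕₚ.m≤m⊔n M N) n≥))
  (q m n (ℕₚ.≤-trans (ℕₚ.m≤n⊔m M N) m≥) (ℕₚ.≤-trans (ℕₚ.m≤n⊔m M N) n≥)))

small-dominated : ∀ {E F} N → (∀ m n → N ℕ.≤ m → N ℕ.≤ n → E m n ≤ F m n) → Small F → Small E
small-dominated N dom f ε 0<ε with f ε 0<ε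
... | M , p = N ℕ.⊔ M , λ m n m≥ n≥ → ℚₚ.≤-trans
  (dom m n (ℕₚ.≤-trans (ℕₚ.m≤m⊔n N M) m≥) (ℕₚ.≤-trans (ℕₚ.m≤m⊔n N M) n≥))
  (p m n (ℕₚ.≤-trans (ℕₚ.m≤n⊔m N M) m≥) (ℕₚ.≤-trans (ℕₚ.m≤n⊔m N M) n≥))

small-* : ∀ {E} C → 0ℚ ≤ C → Small E → Small (λ m n → C * E m n)
small-* {E} C 0≤C e ε 0<ε with e (recip (1ℚ + C) * ε) (0<* (recip-pos 0<1+C) 0<ε)
  where
  0<1+C : 0ℚ < 1ℚ + C
  0<1+C = ℚₚ.<-≤-trans 0<1 (p≤p+q 1ℚ 0≤C)
... | N , p = N , λ m n m≥ n≥ → ℚₚ.≤-trans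
  (ℚₚ.*-monoˡ-≤-nonNeg C {{ℚ.nonNegative 0≤C}} (p m n m≥ n≥))
  (ℚₚ.≤-trans
    (ℚₚ.*-monoʳ-≤-nonNeg (recip (1ℚ + C) * ε) {{ℚ.nonNegative (ℚₚ.<⇒≤ (0<* (recip-pos 0<1+C) 0<ε))}}
      (q≤p+q C 0≤1))
    (ℚₚ.≤-reflexive (trans (sym (ℚₚ.*-assoc (1ℚ + C) _ ε))
      (trans (cong (_* ε) (recip-inverseʳ 0<1+C)) (ℚₚ.*-identityˡ ε)))))
  where
  0<1+C : 0ℚ < 1ℚ + C
  0<1+C = ℚₚ.<-≤-trans 0<1 (p≤p+q 1ℚ 0≤C)

opaque
  unfolding fromℤ

  suc-inverse : ∀ d → fromℕ (suc d) * mkℚ (+ 1) d (1-coprimeTo (suc d)) ≡ 1ℚ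
  suc-inverse d = ℚₚ.*-inverseʳ (fromℕ (suc d))

archimedean : ∀ ε → 0ℚ < ε → ∃[ N ] (∀ n → N ℕ.≤ n → recip (fromℕ (suc n)) ≤ ε)
archimedean ε@(mkℚ a d _) 0<ε = suc d , bound
  where
  num : ∀ {ε} → 0ℚ < ε → + 1 ℤ.≤ ↥ ε
  num {mkℚ a d _} (*<* lt) = ℤₚ.i<j⇒suc[i]≤j (subst (+ 0 ℤ.<_) (ℤₚ.*-identityʳ a) lt)
  d⁻¹≤ε : recip (fromℕ (suc d)) ≤ ε
  d⁻¹≤ε = ≤-by (recip-unique (0<fromℕ (ℕ.s≤s ℕ.z≤n)) d*u≡1) refl
    (*≤* (ℤₚ.*-monoʳ-≤-nonNeg (+ suc d) (num 0<ε)))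
    where
    u : ℚ
    u = mkℚ (+ 1) d (1-coprimeTo (suc d))
    d*u≡1 : fromℕ (suc d) * u ≡ 1ℚ
    d*u≡1 = suc-inverse d
  1≤dε : 1ℚ ≤ fromℕ (suc d) * ε
  1≤dε = ≤-by (recip-inverseʳ (0<fromℕ {suc d} (ℕ.s≤s ℕ.z≤n))) refl
    (ℚₚ.*-monoˡ-≤-nonNeg (fromℕ (suc d)) {{ℚ.nonNegative (0≤fromℕ (suc d))}} d⁻¹≤ε)
  bound : ∀ n → suc d ℕ.≤ n → recip (fromℕ (suc n)) ≤ ε
  bound n d<n = ≤-by
    (ℚₚ.*-identityʳ r)
    (trans (sym (ℚₚ.*-assoc r (fromℕ (suc n)) ε))
      (trans (cong (_* ε) (trans (ℚₚ.*-comm r (fromℕ (suc n))) (recip-inverseʳ 0<n)))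
        (ℚₚ.*-identityˡ ε)))
    (ℚₚ.*-monoˡ-≤-nonNeg r {{ℚ.nonNegative (0≤recip 0<n)}}
      (ℚₚ.≤-trans 1≤dε (ℚₚ.*-monoʳ-≤-nonNeg ε {{ℚ.nonNegative (ℚₚ.<⇒≤ 0<ε)}}
        (fromℕ-mono-≤ (ℕₚ.m≤n⇒m≤1+n d<n)))))
    where
    r = recip (fromℕ (suc n))
    0<n : 0ℚ < fromℕ (suc n)
    0<n = 0<fromℕ (ℕ.s≤s ℕ.z≤n)

bounded : ∀ x → ∃[ B ] (0ℚ ≤ B × Eventually (λ n → ∣ seq x n ∣ ≤ B))
bounded x with cauchy x 1ℚ 0<1
... | N , p = 1ℚ + ∣ seq x N ∣ , 0≤+ 0≤1 (ℚₚ.0≤∣p∣ (seq x N)) , N , λ n n≥ → ℚₚ.≤-trans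
  (≤-by (cong ∣_∣ (solve 2 (λ a b → (a :- b) :+ b := a) refl (seq x n) (seq x N))) refl
    (ℚₚ.∣p+q∣≤∣p∣+∣q∣ (seq x n - seq x N) (seq x N)))
  (ℚₚ.+-monoˡ-≤ ∣ seq x N ∣ (p n N n≥ ℕₚ.≤-refl))

fromℚ : ℚ → ℝ
fromℚ q = mkℝ (λ _ → q) λ ε 0<ε → 0 , λ _ _ _ _ → ≤-by (sym (∣p-p∣ q)) refl (ℚₚ.<⇒≤ 0<ε)

infixl 6 _+ᴿ_ _-ᴿ_
infixl 7 _*ᴿ_ _⊓ᴿ_
infix  8 -ᴿ_

_+ᴿ_ : ℝ → ℝ → ℝ
x +ᴿ y = mkℝ (λ n → seq x n + seq y n)
  (small-dominated 0 (λ m n _ _ → +-lipschitz (seq x m) (seq y m) (seq x n) (seq y n))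
    (small-+ (cauchy x) (cauchy y)))

-ᴿ_ : ℝ → ℝ
-ᴿ x = mkℝ (λ n → - seq x n)
  (small-dominated 0 (λ m n _ _ → ℚₚ.≤-reflexive (neg-lipschitz (seq x m) (seq x n))) (cauchy x))

_-ᴿ_ : ℝ → ℝ → ℝ
x -ᴿ y = x +ᴿ (-ᴿ y)

_⊓ᴿ_ : ℝ → ℝ → ℝ
x ⊓ᴿ y = mkℝ (λ n → seq x n ⊓ seq y n)
  (small-dominated 0 (λ m n _ _ → ⊓-lipschitz (seq x m) (seq y m) (seq x n) (seq y n))
    (small-+ (cauchy x) (cauchy y)))

∣_∣ᴿ : ℝ → ℝ
∣ x ∣ᴿ = mkℝ (λ n → ∣ seq x n ∣) (small-dominated 0 (λ m n _ _ → lip (seq x m) (seq x n)) (cauchy x))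
  where
  half : ∀ p q → ∣ p ∣ ≤ ∣ q ∣ + ∣ p - q ∣
  half p q = ≤-by (cong ∣_∣ (solve 2 (λ p q → q :+ (p :- q) := p) refl p q)) refl
    (ℚₚ.∣p+q∣≤∣p∣+∣q∣ q (p - q))
  lip : ∀ p q → ∣ ∣ p ∣ - ∣ q ∣ ∣ ≤ ∣ p - q ∣
  lip p q = ∣-∣-≤ (half p q) (≤-by refl (cong (_+_ ∣ p ∣) (∣-∣-sym q p)) (half q p))

*-cauchy-bounded : ∀ x y B C M N →
  0ℚ ≤ B → (∀ n → M ℕ.≤ n → ∣ seq x n ∣ ≤ B) →
  0ℚ ≤ C → (∀ n → N ℕ.≤ n → ∣ seq y n ∣ ≤ C) →
  Cauchy (λ n → seq x n * seq y n)
*-cauchy-bounded x y B C M N 0≤B x≤B 0≤C y≤C = small-dominated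
  {λ m n → ∣ seq x m * seq y m - seq x n * seq y n ∣}
  {λ m n → B * ∣ seq y m - seq y n ∣ + C * ∣ seq x m - seq x n ∣}
  (M ℕ.⊔ N)
  (λ m n m≥ n≥ → *-lipschitz (seq x m) (seq y m) (seq x n) (seq y n)
    (x≤B m (ℕₚ.≤-trans (ℕₚ.m≤m⊔n M N) m≥)) (y≤C n (ℕₚ.≤-trans (ℕₚ.m≤n⊔m M N) n≥)))
  (small-+ {λ m n → B * ∣ seq y m - seq y n ∣} {λ m n → C * ∣ seq x m - seq x n ∣}
    (small-* {λ m n → ∣ seq y m - seq y n ∣} B 0≤B (cauchy y))
    (small-* {λ m n → ∣ seq x m - seq x n ∣} C 0≤C (cauchy x)))

*-cauchy : ∀ x y → Cauchy (λ n → seq x n * seq y n)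
*-cauchy x y =
  let (B , 0≤B , M , x≤B) = bounded x
      (C , 0≤C , N , y≤C) = bounded y
  in *-cauchy-bounded x y B C M N 0≤B x≤B 0≤C y≤C

_*ᴿ_ : ℝ → ℝ → ℝ
x *ᴿ y = mkℝ (λ n → seq x n * seq y n) (*-cauchy x y)

recip-cauchy : ∀ x → Positive x → Cauchy (λ n → recip (seq x n))
recip-cauchy x (δ , 0<δ , N , δ≤x) =
  small-dominated
    {λ m n → ∣ recip (seq x m) - recip (seq x n) ∣}
    {λ m n → (recip δ * recip δ) * ∣ seq x m - seq x n ∣}
    N
    (λ m n m≥ n≥ → ≤-by refl (ℚₚ.*-comm ∣ seq x m - seq x n ∣ _)
      (recip-lipschitz 0<δ (δ≤x m m≥) (δ≤x n n≥)))
    (small-* {λ m n → ∣ seq x m - seq x n ∣} (recip δ * recip δ) (0≤* (0≤recip 0<δ) (0≤recip 0<δ)) (cauchy x))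

recipᴿ : (x : ℝ) → Positive x → ℝ
recipᴿ x 0<x = mkℝ (λ n → recip (seq x n)) (recip-cauchy x 0<x)

infixl 7 _÷ᴿ_[_]

_÷ᴿ_[_] : ℝ → (y : ℝ) → Positive y → ℝ
x ÷ᴿ y [ 0<y ] = x *ᴿ recipᴿ y 0<y

riemann-cauchy-bounded : ∀ y δ N B M →
  0ℚ < δ → (∀ n → N ℕ.≤ n → δ ≤ seq y n) →
  0ℚ ≤ B → (∀ n → M ℕ.≤ n → ∣ seq y n - 1ℚ ∣ ≤ B) →
  Cauchy (λ n → riemann (seq y n) (suc n))
riemann-cauchy-bounded y δ N B M 0<δ δ≤y 0≤B y≤B =
  small-dominated
    {λ m n → ∣ riemann (seq y m) (suc m) - riemann (seq y n) (suc n) ∣}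
    {λ m n → c * ∣ seq y m - seq y n ∣ + (B * B * c) * (recip (fromℕ (suc m)) + recip (fromℕ (suc n)))}
    (N ℕ.⊔ M)
    (λ m n m≥ n≥ → riemann-near 0<δ⊓1 (ℚₚ.p⊓q≤q δ 1ℚ)
      (ℚₚ.≤-trans (ℚₚ.p⊓q≤p δ 1ℚ) (δ≤y m (ℕₚ.≤-trans (ℕₚ.m≤m⊔n N M) m≥)))
      (ℚₚ.≤-trans (ℚₚ.p⊓q≤p δ 1ℚ) (δ≤y n (ℕₚ.≤-trans (ℕₚ.m≤m⊔n N M) n≥)))
      (y≤B m (ℕₚ.≤-trans (ℕₚ.m≤n⊔m N M) m≥)) (y≤B n (ℕₚ.≤-trans (ℕₚ.m≤n⊔m N M) n≥))
      (ℕ.s≤s ℕ.z≤n) (ℕ.s≤s ℕ.z≤n))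
    (small-+ {λ m n → c * ∣ seq y m - seq y n ∣}
             {λ m n → (B * B * c) * (recip (fromℕ (suc m)) + recip (fromℕ (suc n)))}
      (small-* {λ m n → ∣ seq y m - seq y n ∣} c 0≤c (cauchy y))
      (small-* {λ m n → recip (fromℕ (suc m)) + recip (fromℕ (suc n))} (B * B * c)
        (0≤* (0≤* 0≤B 0≤B) 0≤c) mesh))
  where
  0<δ⊓1 : 0ℚ < δ ⊓ 1ℚ
  0<δ⊓1 with ℚₚ.⊓-sel δ 1ℚ
  ... | inj₁ eq = subst (0ℚ <_) (sym eq) 0<δ
  ... | inj₂ eq = subst (0ℚ <_) (sym eq) 0<1
  c = recip (δ ⊓ 1ℚ) * recip (δ ⊓ 1ℚ)
  0≤c : 0ℚ ≤ c
  0≤c = 0≤* (0≤recip 0<δ⊓1) (0≤recip 0<δ⊓1)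
  mesh : Small (λ m n → recip (fromℕ (suc m)) + recip (fromℕ (suc n)))
  mesh = small-+ {λ m n → recip (fromℕ (suc m))} {λ m n → recip (fromℕ (suc n))}
    (λ ε 0<ε → let K , p = archimedean ε 0<ε in K , λ m n m≥ _ → p m m≥)
    (λ ε 0<ε → let K , p = archimedean ε 0<ε in K , λ m n _ n≥ → p n n≥)

riemann-cauchy : ∀ y → Positive y → Cauchy (λ n → riemann (seq y n) (suc n))
riemann-cauchy y (δ , 0<δ , N , δ≤y) =
  let (B , 0≤B , M , y≤B) = bounded (y -ᴿ fromℚ 1ℚ)
  in riemann-cauchy-bounded y δ N B M 0<δ δ≤y 0≤B y≤B

-- ln y = ∫₁^y dt/t
ln : (y : ℝ) → Positive y → ℝ
ln y 0<y = mkℝ (λ n → riemann (seq y n) (suc n)) (riemann-cauchy y 0<y)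

dist : ℝ → ℝ
dist x = mkℝ (λ n → distℤ (seq x n))
  (small-dominated 0 (λ m n _ _ → distℤ-lipschitz (seq x m) (seq x n)) (cauchy x))

-- dist x is the infimum of the distances ∣ x - k ∣ with k ∈ ℤ.

dist-lower : ∀ x k → dist x ≤ᴿ ∣ x -ᴿ fromℚ (fromℤ k) ∣ᴿ
dist-lower x k ε 0<ε = always λ n →
  ℚₚ.≤-trans (distℤ-≤ (seq x n) k) (p≤p+q _ (ℚₚ.<⇒≤ 0<ε))

dist-greatest : ∀ x r → (∀ k → r ≤ᴿ ∣ x -ᴿ fromℚ (fromℤ k) ∣ᴿ) → r ≤ᴿ dist x
dist-greatest x r lower ε 0<ε =
  let N , close = cauchy x ε₄ 0<ε₄
      k , eq    = distℤ-attained (seq x N)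
      M , below = lower k ε₄ 0<ε₄
  in N ℕ.⊔ M , λ n n≥ → bound N k eq n
       (close n N (ℕₚ.≤-trans (ℕₚ.m≤m⊔n N M) n≥) ℕₚ.≤-refl)
       (below n (ℕₚ.≤-trans (ℕₚ.m≤n⊔m N M) n≥))
  where
  ε₄ = ½ * (½ * ε)
  0<ε₄ : 0ℚ < ε₄
  0<ε₄ = 0<½* (0<½* 0<ε)
  bound : ∀ N k → distℤ (seq x N) ≡ ∣ seq x N - fromℤ k ∣ → ∀ n →
    ∣ seq x n - seq x N ∣ ≤ ε₄ → seq r n ≤ ∣ seq x n - fromℤ k ∣ + ε₄ →
    seq r n ≤ distℤ (seq x n) + ε
  bound N k eq n close below = ℚₚ.≤-trans below (ℚₚ.≤-trans (ℚₚ.+-monoˡ-≤ ε₄ near) (≤-by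
    refl (cong (_+_ D) (½+½ ε)) (≤-by
      (solve 2 (λ D e → D :+ ((e :+ e) :+ e) := ((e :+ (D :+ e))) :+ e) refl D ε₄) refl
      (ℚₚ.+-monoʳ-≤ D (≤-by refl (cong₂ _+_ (½+½ (½ * ε)) refl)
        (≤-by refl (cong (_+_ (ε₄ + ε₄)) (½+½ (½ * ε))) (ℚₚ.+-monoʳ-≤ (ε₄ + ε₄) (p≤p+q ε₄ (ℚₚ.<⇒≤ 0<ε₄)))))))))
    where
    D = distℤ (seq x n)
    near : ∣ seq x n - fromℤ k ∣ ≤ ε₄ + (D + ε₄)
    near = ℚₚ.≤-trans (∣-∣-triangle (seq x n) (seq x N) (fromℤ k))
      (ℚₚ.+-mono-≤ close (≤-by eq refl
        (ℚₚ.≤-trans (p≤q+∣p-q∣ (distℤ (seq x N)) D)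
          (ℚₚ.+-monoʳ-≤ D (ℚₚ.≤-trans (distℤ-lipschitz (seq x N) (seq x n))
            (≤-by (∣-∣-sym (seq x n) (seq x N)) refl close))))))

-- Equality in 𝕋 = ℝ/ℤ, whose points are given by real representatives.
_≈ᵀ_ : ℝ → ℝ → Set
s ≈ᵀ t = ∃[ k ] s -ᴿ t ≈ᴿ fromℚ (fromℤ k)

𝕋 : Setoid 0ℓ 0ℓ
𝕋 = record
  { Carrier = ℝ
  ; _≈_ = _≈ᵀ_
  ; isEquivalence = record
    { refl  = λ {s} → ≈ᵀ-refl s
    ; sym   = λ {s} {t} → ≈ᵀ-sym s t
    ; trans = λ {s} {t} {u} → ≈ᵀ-trans s t u
    }
  }
  where
  ≈ᵀ-refl : ∀ s → s ≈ᵀ s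
  ≈ᵀ-refl s = + 0 , λ ε 0<ε → always λ n →
    ≤-by (sym (trans (cong₂ (λ p q → ∣ p - q ∣) (ℚₚ.+-inverseʳ (seq s n)) fromℕ-0) (∣p-p∣ 0ℚ)))
      refl (ℚₚ.<⇒≤ 0<ε)
  ≈ᵀ-sym : ∀ s t → s ≈ᵀ t → t ≈ᵀ s
  ≈ᵀ-sym s t (k , eq) = ℤ.- k , λ ε 0<ε → let N , p = eq ε 0<ε in N , λ n n≥ →
    ≤-by (trans (sym (neg-lipschitz (seq s n - seq t n) (fromℤ k)))
      (cong₂ (λ p q → ∣ p - q ∣)
        (solve 2 (λ s t → :- (s :- t) := t :- s) refl (seq s n) (seq t n)) (sym (fromℤ-neg k))))
      refl (p n n≥)
  ≈ᵀ-trans : ∀ s t u → s ≈ᵀ t → t ≈ᵀ u → s ≈ᵀ u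
  ≈ᵀ-trans s t u (k , eq) (l , eq′) = k ℤ.+ l , λ ε 0<ε →
    both (λ {n} p q → ≤-by
        (cong₂ (λ p q → ∣ p - q ∣)
          (solve 3 (λ s t u → (s :- t) :+ (t :- u) := s :- u) refl (seq s n) (seq t n) (seq u n))
          (sym (fromℤ-+ k l)))
        (½+½ ε)
        (ℚₚ.≤-trans (+-lipschitz (seq s n - seq t n) (seq t n - seq u n) (fromℤ k) (fromℤ l))
          (ℚₚ.+-mono-≤ p q)))
      (eq (½ * ε) (0<½* 0<ε)) (eq′ (½ * ε) (0<½* 0<ε))

ρ : Setoid.Carrier 𝕋 → Setoid.Carrier 𝕋 → ℝ
ρ s t = dist (s -ᴿ t)

ρ-cong : ∀ s s′ t t′ → s ≈ᵀ s′ → t ≈ᵀ t′ → ρ s t ≈ᴿ ρ s′ t′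
ρ-cong s s′ t t′ (k , eq) (l , eq′) ε 0<ε =
  both (λ {n} p q → ℚₚ.≤-trans
      (≤-by (cong (λ z → ∣ distℤ (seq s n - seq t n) - z ∣) (distℤ-shift (seq s′ n - seq t′ n) (k ℤ.- l))) refl
        (distℤ-lipschitz (seq s n - seq t n) ((seq s′ n - seq t′ n) + fromℤ (k ℤ.- l))))
      (≤-by
        (cong ∣_∣ (trans
          (solve 6 (λ s s′ t t′ k l →
              ((s :- s′) :- k) :+ :- ((t :- t′) :- l) := (s :- t) :- ((s′ :- t′) :+ (k :+ :- l)))
            refl (seq s n) (seq s′ n) (seq t n) (seq t′ n) (fromℤ k) (fromℤ l))
          (cong (λ z → (seq s n - seq t n) - ((seq s′ n - seq t′ n) + z))
            (sym (trans (fromℤ-+ k (ℤ.- l)) (cong (_+_ (fromℤ k)) (fromℤ-neg l)))))))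
        (½+½ ε)
        (ℚₚ.≤-trans (ℚₚ.∣p-q∣≤∣p∣+∣q∣ ((seq s n - seq s′ n) - fromℤ k) ((seq t n - seq t′ n) - fromℤ l))
          (ℚₚ.+-mono-≤ p q))))
    (eq (½ * ε) (0<½* 0<ε)) (eq′ (½ * ε) (0<½* 0<ε))

-- 1, …, n
range : ℕ → List ℕ
range n = applyUpTo suc n

-- The pairs (r , s) with 1 ≤ r < s ≤ n.
pairs : ℕ → List (ℕ × ℕ)
pairs n = concatMap (λ s → map (_, s) (range (s ℕ.∸ 1))) (range n)

-- A sequence is a function on ℕ whose value at 0 plays no role.  For n ≥ 2
-- the starting value of the fold is itself one of the terms of the minimum.
d : (ℕ → Setoid.Carrier 𝕋) → ℕ → ℝ
d x n = foldr _⊓ᴿ_ (ρ (x 1) (x 2)) (map (λ (r , s) → ρ (x r) (x s)) (pairs n))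

*-positive : ∀ {x y} → Positive x → Positive y → Positive (x *ᴿ y)
*-positive (δ , 0<δ , x≥) (η , 0<η , y≥) = δ * η , 0<* 0<δ 0<η ,
  both (λ p q → *-mono-≤ (ℚₚ.<⇒≤ 0<δ) (ℚₚ.≤-trans (ℚₚ.<⇒≤ 0<η) q) p q) x≥ y≥

fromℕ-positive : ∀ {n} → 1 ℕ.≤ n → Positive (fromℚ (fromℕ n))
fromℕ-positive 1≤n = 1ℚ , 0<1 , always λ _ → 1≤fromℕ 1≤n

lnℕ : (n : ℕ) → 1 ℕ.≤ n → ℝ
lnℕ n 1≤n = ln (fromℚ (fromℕ n)) (fromℕ-positive 1≤n)

2ln2 : ℝ
2ln2 = fromℚ (fromℕ 2) *ᴿ lnℕ 2 (ℕ.s≤s ℕ.z≤n)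

ln2-positive : Positive (lnℕ 2 (ℕ.s≤s ℕ.z≤n))
ln2-positive = recip 2ℚ , recip-pos 0<2 , always λ n → bound (suc n) (ℕ.s≤s ℕ.z≤n)
  where
  2ℚ = fromℕ 2
  0<2 : 0ℚ < 2ℚ
  0<2 = 0<fromℕ (ℕ.s≤s ℕ.z≤n)
  1≤2 : 1ℚ ≤ 2ℚ
  1≤2 = 1≤fromℕ (ℕ.s≤s ℕ.z≤n)
  2-1 : 2ℚ - 1ℚ ≡ 1ℚ
  2-1 = trans (cong (_- 1ℚ) (trans (fromℕ-suc 1) (cong (_+_ 1ℚ) fromℕ-1))) refl
  2≡ : 1ℚ + 1ℚ ≡ 2ℚ
  2≡ = sym (trans (fromℕ-suc 1) (cong (_+_ 1ℚ) fromℕ-1))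
  bound : ∀ N → 1 ℕ.≤ N → recip 2ℚ ≤ riemann 2ℚ N
  bound N 1≤N = ≤-by
    (trans (sym (ℚₚ.*-assoc (fromℕ N) h (recip 2ℚ)))
      (trans (cong (_* recip 2ℚ) N*h) (ℚₚ.*-identityˡ (recip 2ℚ))))
    refl
    (sumℚ-≥ N (h * recip 2ℚ) λ j j<N →
      ℚₚ.*-monoˡ-≤-nonNeg h {{ℚ.nonNegative 0≤h}}
        (recip-anti (ℚₚ.<-≤-trans 0<1 (node-≥ ℚₚ.≤-refl 1≤2 1≤N (ℕₚ.<⇒≤ j<N)))
          (≤-by refl (trans (cong (_+_ 1ℚ) N*h) 2≡)
            (ℚₚ.+-monoʳ-≤ 1ℚ (ℚₚ.*-monoʳ-≤-nonNeg h {{ℚ.nonNegative 0≤h}} (fromℕ-mono-≤ (ℕₚ.<⇒≤ j<N)))))))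
    where
    h = step 2ℚ N
    N*h : fromℕ N * h ≡ 1ℚ
    N*h = trans (N*step 2ℚ 1≤N) 2-1
    0≤h : 0ℚ ≤ h
    0≤h = 0≤* (≤-by refl (sym 2-1) 0≤1) (0≤recip (0<fromℕ 1≤N))

2ln2-positive : Positive 2ln2
2ln2-positive = *-positive {fromℚ (fromℕ 2)} {lnℕ 2 (ℕ.s≤s ℕ.z≤n)}
  (fromℕ-positive (ℕ.s≤s ℕ.z≤n)) ln2-positive

φ : (m : ℕ) → 1 ℕ.≤ m → ℝ
φ m 1≤m = (lnℕ (m ℕ.+ 1) (ℕₚ.m≤n⇒m≤n+o 1 1≤m) -ᴿ lnℕ m 1≤m) ÷ᴿ 2ln2 [ 2ln2-positive ]

{-# OPTIONS --safe #-}

-- If every two of 2n points on the circle, i and j, are at distance at least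
-- h i + h j, then adding up the 2n gaps between neighbours gives 2 Σ h ≤ 1.
-- Put w j = d (j + 1), which is antitone and bounds the distances of the point j
-- from its predecessors, and h j = w n / 2 + min (w j - w n) 0: the inequality
-- becomes 2 Σ_{n ≤ j < 2n} w j ≤ 1.  The sum of φ over the same range telescopes
-- to (ln 2n - ln n) / 2 ln 2 = 1/2, so d ≤ φ at one of these indices.
module Submission where

open import Defs
open import Level using (0ℓ)
open import Data.Nat.Base using (ℕ; _≤_; _∸_)
open import Data.Nat.Properties using (∸-monoˡ-≤)
open import Data.Product.Base using (_×_; ∃-syntax; Σ-syntax)
open import Relation.Binary.Bundles using (Setoid)
open import Axiom.ExcludedMiddle using (ExcludedMiddle)

open import Data.Nat.Base as ℕ using (zero; suc)
import Data.Nat.Properties as ℕₚ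
open import Data.Integer.Base as ℤ using (+_)
import Data.Integer.Properties as ℤₚ
open import Data.Rational.Base as ℚ using (ℚ; 0ℚ; 1ℚ; ½; _+_; _-_; _*_; -_; _⊓_; ∣_∣; floor)
import Data.Rational.Properties as ℚₚ
open import Data.Rational.Solver using (module +-*-Solver)
open import Data.List.Base using (List; []; _∷_; foldr; map; length; applyUpTo; upTo)
open import Data.List.Properties using (map-applyUpTo; length-upTo)
open import Data.List.Membership.Propositional using (_∈_; find; lose)
open import Data.List.Membership.Propositional.Properties
  using (∈-applyUpTo⁺; ∈-applyUpTo⁻; ∈-concatMap⁺; ∈-concatMap⁻; ∈-map⁺; ∈-map⁻)
open import Data.List.Relation.Binary.Permutation.Propositional using (↭-sym; ↭⇒↭ₛ)
open import Data.List.Relation.Binary.Permutation.Propositional.Properties using (map⁺; ↭-length)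
import Data.List.Relation.Binary.Permutation.Setoid.Properties as ↭ₛ
open import Data.List.Relation.Unary.All using (All; []; _∷_)
open import Data.List.Relation.Unary.AllPairs using (AllPairs; []; _∷_)
import Data.List.Relation.Unary.AllPairs.Properties as AllPairsₚ
open import Data.List.Relation.Unary.Any using (here; there)
open import Data.List.Relation.Unary.Sorted.TotalOrder.Properties using (Sorted⇒AllPairs)
import Data.List.Sort as Sort
open import Data.Product.Base using (_,_; proj₂)
open import Data.Sum.Base using (_⊎_; inj₁; inj₂)
open import Relation.Binary.Bundles using (DecTotalOrder)
import Relation.Binary.Construct.On as On
open import Relation.Binary.PropositionalEquality
  using (_≡_; refl; sym; trans; cong; cong₂; subst; setoid; resp₂)
open import Relation.Nullary using (¬_; yes; no; contradiction)

open +-*-Solver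

-- Linear inequalities and finite sums of rationals.

-- Serves as a linear arithmetic tactic: known inequalities are added up to `r ≤ s`, and the goal is
-- left as a ring identity for the solver.
≤-by-diff : ∀ {p q r s} → r ℚ.≤ s → s - r ≡ q - p → p ℚ.≤ q
≤-by-diff {p} {q} {r} {s} r≤s eq = ≤-by (ℚₚ.+-identityˡ p)
  (trans (cong (_+ p) eq) (solve 2 (λ p q → (q :- p) :+ p := q) refl p q))
  (ℚₚ.+-monoˡ-≤ p (0≤q-p r≤s))

sumℚ-≤-+ : ∀ n {u f g} → (∀ i → i ℕ.< n → u i ℚ.≤ f i + g i) → sumℚ n u ℚ.≤ sumℚ n f + sumℚ n g
sumℚ-≤-+ zero _ = ℚₚ.≤-refl
sumℚ-≤-+ (suc n) {u} {f} {g} le = ≤-by refl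
  (solve 4 (λ a b c d → (a :+ b) :+ (c :+ d) := (a :+ c) :+ (b :+ d)) refl (f 0) (g 0) _ _)
  (ℚₚ.+-mono-≤ (le 0 (ℕ.s≤s ℕ.z≤n)) (sumℚ-≤-+ n (λ i i<n → le (suc i) (ℕ.s≤s i<n))))

sumℚ-telescope : ∀ n (f : ℕ → ℚ) r → sumℚ n (λ i → (f (suc i) - f i) * r) ≡ (f n - f 0) * r
sumℚ-telescope zero    f r = sym (trans (cong (_* r) (ℚₚ.+-inverseʳ (f 0))) (ℚₚ.*-zeroˡ r))
sumℚ-telescope (suc n) f r = trans (cong (_+_ ((f 1 - f 0) * r)) (sumℚ-telescope n (λ i → f (suc i)) r))
  (solve 4 (λ a b c r → (b :- a) :* r :+ (c :- b) :* r := (c :- a) :* r) refl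
    (f 0) (f 1) (f (suc n)) r)

foldr-applyUpTo : ∀ n f → foldr _+_ 0ℚ (applyUpTo f n) ≡ sumℚ n f
foldr-applyUpTo zero    f = refl
foldr-applyUpTo (suc n) f = cong (_+_ (f 0)) (foldr-applyUpTo n (λ i → f (suc i)))

-- Packing the circle

distℤ-swap-≤ : ∀ p q → distℤ (p - q) ℚ.≤ distℤ (q - p)
distℤ-swap-≤ p q with distℤ-attained (q - p)
... | k , eq = ≤-by refl
  (trans (cong (λ z → ∣ (p - q) - z ∣) (fromℤ-neg k)) (trans (trans
    (cong ∣_∣ (solve 3 (λ p q k → (p :- q) :- (:- k) := :- ((q :- p) :- k)) refl p q (fromℤ k)))
    (ℚₚ.∣-p∣≡∣p∣ ((q - p) - fromℤ k))) (sym eq)))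
  (distℤ-≤ (p - q) (ℤ.- k))

distℤ-≤-gap : ∀ p q → p ℚ.≤ q → distℤ (p - q) ℚ.≤ q - p
distℤ-≤-gap p q p≤q = ≤-by refl
  (trans (cong (λ z → ∣ (p - q) - z ∣) fromℕ-0) (trans (cong ∣_∣ (ℚₚ.+-identityʳ (p - q)))
    (trans (∣-∣-sym p q) (ℚₚ.0≤p⇒∣p∣≡p (0≤q-p p≤q)))))
  (distℤ-≤ (p - q) (+ 0))

distℤ-≤-around : ∀ p q → q ℚ.≤ 1ℚ + p → distℤ (p - q) ℚ.≤ (1ℚ + p) - q
distℤ-≤-around p q q≤1+p = ≤-by refl
  (trans (cong (λ z → ∣ (p - q) - z ∣) (trans (fromℤ-neg (+ 1)) (cong -_ fromℕ-1)))
    (trans (cong ∣_∣ (solve 2 (λ p q → (p :- q) :- (:- con 1ℚ) := (con 1ℚ :+ p) :- q) refl p q))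
      (ℚₚ.0≤p⇒∣p∣≡p (0≤q-p q≤1+p))))
  (distℤ-≤ (p - q) (ℤ.- (+ 1)))

frac : ℚ → ℚ
frac q = q - fromℤ (floor q)

0≤frac : ∀ q → 0ℚ ℚ.≤ frac q
0≤frac q = 0≤q-p (floor≤ q)

frac≤1 : ∀ q → frac q ℚ.≤ 1ℚ
frac≤1 q = p≤q+r⇒p-q≤r {q} {fromℤ (floor q)} (≤-by refl (ℚₚ.+-comm 1ℚ (fromℤ (floor q))) (ℚₚ.<⇒≤ (ℚₚ.≰⇒> λ le →
  ℤₚ.<-irrefl refl (ℤₚ.suc[i]≤j⇒i<j (floor-max (ℤ.suc (floor q)) q
    (≤-by (sym (trans (fromℤ-+ (+ 1) (floor q)) (cong (ℚ._+ fromℤ (floor q)) fromℕ-1))) refl le))))))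

distℤ-frac : ∀ p q → distℤ (frac p - frac q) ≡ distℤ (p - q)
distℤ-frac p q = trans
  (cong distℤ (trans
    (solve 4 (λ p q k l → (p :- k) :- (q :- l) := (p :- q) :+ (l :+ :- k)) refl p q (fromℤ (floor p)) (fromℤ (floor q)))
    (cong (_+_ (p - q)) (sym (trans (fromℤ-+ (floor q) (ℤ.- floor p)) (cong (_+_ (fromℤ (floor q))) (fromℤ-neg (floor p))))))))
  (distℤ-shift (p - q) (floor q ℤ.- floor p))

module _ (h y : ℕ → ℚ) (0≤y : ∀ i → 0ℚ ℚ.≤ y i) (y≤1 : ∀ i → y i ℚ.≤ 1ℚ) where

  -- The weights `h` may be negative, so they are not radii of disjoint arcs; the bound comes from
  -- adding inequalities between gaps.
  Separated : ℕ → ℕ → Set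
  Separated i j = h i + h j ℚ.≤ distℤ (y i - y j)

  private
    total : List ℕ → ℚ
    total is = foldr _+_ 0ℚ (map h is)

    byHeight : DecTotalOrder 0ℓ 0ℓ 0ℓ
    byHeight = On.decTotalOrder ℚₚ.≤-decTotalOrder y

    separated-sym : ∀ {i j} → Separated i j → Separated j i
    separated-sym {i} {j} sep =
      ≤-by (ℚₚ.+-comm (h i) (h j)) refl (ℚₚ.≤-trans sep (distℤ-swap-≤ (y i) (y j)))

    y≤1+y : ∀ i j → y j ℚ.≤ 1ℚ + y i
    y≤1+y i j = ℚₚ.≤-trans (y≤1 j) (p≤p+q 1ℚ (0≤y i))

    -- The sum of the gaps between the points of b ∷ is and of the gap from the
    -- last of them around to a.
    chain : ∀ a b is → All (Separated a) (b ∷ is) → AllPairs Separated (b ∷ is) →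
      AllPairs (λ i j → y i ℚ.≤ y j) (b ∷ is) →
      (total (b ∷ is) + total (b ∷ is)) + (h a + y b) ℚ.≤ (1ℚ + y a) + h b
    chain a b [] (sep ∷ []) _ _ = ≤-by-diff
      (ℚₚ.≤-trans sep (distℤ-≤-around (y a) (y b) (y≤1+y a b)))
      (solve 4 (λ ha hb ya yb → ((con 1ℚ :+ ya) :- yb) :- (ha :+ hb)
        := ((con 1ℚ :+ ya) :+ hb) :- (((hb :+ con 0ℚ) :+ (hb :+ con 0ℚ)) :+ (ha :+ yb)))
        refl (h a) (h b) (y a) (y b))
    chain a b (c ∷ is) (_ ∷ seps) ((sep ∷ _) ∷ pairs) ((b≤c ∷ _) ∷ sorted) = ≤-by-diff
      (ℚₚ.+-mono-≤ (chain a c is seps pairs sorted) (ℚₚ.≤-trans sep (distℤ-≤-gap (y b) (y c) b≤c)))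
      (solve 7 (λ ha hb hc ya yb yc t →
          (((con 1ℚ :+ ya) :+ hc) :+ (yc :- yb)) :- ((((hc :+ t) :+ (hc :+ t)) :+ (ha :+ yc)) :+ (hb :+ hc))
        := ((con 1ℚ :+ ya) :+ hb) :- (((hb :+ (hc :+ t)) :+ (hb :+ (hc :+ t))) :+ (ha :+ yb)))
        refl (h a) (h b) (h c) (y a) (y b) (y c) (total is))

    -- The gap from `a` to `b` closes the chain that leads from `b` around to `a`. The gaps then add
    -- up to 1, and every weight enters with its two neighbouring gaps.
    circle : ∀ a b is → AllPairs Separated (a ∷ b ∷ is) →
      AllPairs (λ i j → y i ℚ.≤ y j) (a ∷ b ∷ is) →
      total (a ∷ b ∷ is) + total (a ∷ b ∷ is) ℚ.≤ 1ℚ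
    circle a b is (seps@(sep ∷ _) ∷ pairs) ((a≤b ∷ _) ∷ sorted) = ≤-by-diff
      (ℚₚ.+-mono-≤ (chain a b is seps pairs sorted) (ℚₚ.≤-trans sep (distℤ-≤-gap (y a) (y b) a≤b)))
      (solve 5 (λ ha hb ya yb t →
          (((con 1ℚ :+ ya) :+ hb) :+ (yb :- ya)) :- (((t :+ t) :+ (ha :+ yb)) :+ (ha :+ hb))
        := con 1ℚ :- ((ha :+ t) :+ (ha :+ t)))
        refl (h a) (h b) (y a) (y b) (total (b ∷ is)))

  -- Sorting by height makes neighbours in the list neighbours on the circle. Separation is
  -- symmetric and addition commutative, so both the hypothesis and the sum survive the permutation.
  fractional-packing : (∀ {i j} → i ℕ.< j → Separated i j) → ∀ {n} → 2 ≤ n →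
    sumℚ n h + sumℚ n h ℚ.≤ 1ℚ
  fractional-packing sep {n} 2≤n = subst (λ z → z + z ℚ.≤ 1ℚ)
    (trans
      (↭ₛ.foldr-commMonoid (setoid ℚ) ℚₚ.+-0-isCommutativeMonoid (↭⇒↭ₛ (map⁺ h (sort-↭ (upTo n)))))
      (trans (cong (foldr _+_ 0ℚ) (map-applyUpTo (λ i → i) h n)) (foldr-applyUpTo n h)))
    (bound (sort (upTo n)) (↭-length (sort-↭ (upTo n)))
      (↭ₛ.AllPairs-resp-↭ (setoid ℕ) separated-sym (resp₂ Separated) (↭⇒↭ₛ (↭-sym (sort-↭ (upTo n))))
        (AllPairsₚ.applyUpTo⁺₁ (λ i → i) n (λ i<j _ → sep i<j)))
      (Sorted⇒AllPairs (DecTotalOrder.totalOrder byHeight) (sort-↗ (upTo n))))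
    where
    open Sort byHeight using (sort; sort-↭; sort-↗)
    bound : ∀ is → length is ≡ length (upTo n) → AllPairs Separated is →
      AllPairs (λ i j → y i ℚ.≤ y j) is → total is + total is ℚ.≤ 1ℚ
    bound []           eq _ _ = contradiction (subst (2 ≤_) (sym (trans eq (length-upTo n))) 2≤n) λ ()
    bound (_ ∷ [])     eq _ _ = contradiction (subst (2 ≤_) (sym (trans eq (length-upTo n))) 2≤n) λ { (ℕ.s≤s ()) }
    bound (a ∷ b ∷ is) _      = circle a b is

packing : ∀ (h p : ℕ → ℚ) → (∀ {i j} → i ℕ.< j → h i + h j ℚ.≤ distℤ (p i - p j)) →
  ∀ {n} → 2 ≤ n → sumℚ n h + sumℚ n h ℚ.≤ 1ℚ
packing h p sep = fractional-packing h (λ i → frac (p i)) (λ i → 0≤frac (p i)) (λ i → frac≤1 (p i))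
  λ {i} {j} i<j → ≤-by refl (sym (distℤ-frac (p i) (p j))) (sep i<j)

-- With c = w n, the weights h i = c / 2 + min (w i - c) 0 satisfy
-- h i + h j ≤ w j for i < j as well as w (n + i) ≤ h i + h (n + i) for i < n.
antitone-packing : ∀ (w p : ℕ → ℚ) → (∀ {i j} → i ≤ j → w j ℚ.≤ w i) →
  (∀ {i j} → i ℕ.< j → w j ℚ.≤ distℤ (p i - p j)) →
  ∀ {n} → 1 ≤ n → sumℚ n (λ i → w (n ℕ.+ i)) ℚ.≤ ½
antitone-packing w p anti sep {n} 1≤n = half (ℚₚ.≤-trans
  (ℚₚ.+-mono-≤ sum≤ sum≤) (packing h p h-sep (ℕₚ.+-mono-≤ 1≤n 1≤n)))
  where
  c : ℚ
  c = w n
  h : ℕ → ℚ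
  h i = ½ * c + ((w i - c) ⊓ 0ℚ)
  h-sep : ∀ {i j} → i ℕ.< j → h i + h j ℚ.≤ distℤ (p i - p j)
  -- The minimum in `h i` is bounded by 0 and the one in `h j` by `w j - c`, which leaves exactly
  -- `w j`.
  h-sep {i} {j} i<j = ℚₚ.≤-trans (≤-by refl
    (solve 2 (λ c w → (con ½ :* c :+ con 0ℚ) :+ (con ½ :* c :+ (w :- c)) := w) refl c (w j))
    (ℚₚ.+-mono-≤ (ℚₚ.+-monoʳ-≤ (½ * c) (ℚₚ.p⊓q≤q (w i - c) 0ℚ))
      (ℚₚ.+-monoʳ-≤ (½ * c) (ℚₚ.p⊓q≤p (w j - c) 0ℚ)))) (sep i<j)
  sum≤ : sumℚ n (λ i → w (n ℕ.+ i)) ℚ.≤ sumℚ (n ℕ.+ n) h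
  -- Index `i < n` is paired with `n + i`: as `w` is antitone, the two minima are at least 0 and
  -- `w (n + i) - c` respectively.
  sum≤ = ≤-by refl (sym (sumℚ-+ n n h)) (sumℚ-≤-+ n λ i i<n → ≤-by
    (solve 2 (λ c w → (con ½ :* c :+ con 0ℚ) :+ (con ½ :* c :+ (w :- c)) := w) refl c (w (n ℕ.+ i)))
    refl
    (ℚₚ.+-mono-≤
      (ℚₚ.+-monoʳ-≤ (½ * c) (ℚₚ.⊓-glb (0≤q-p (anti (ℕₚ.<⇒≤ i<n))) ℚₚ.≤-refl))
      (ℚₚ.+-monoʳ-≤ (½ * c) (ℚₚ.⊓-glb ℚₚ.≤-refl
        (≤-by-diff (anti (ℕₚ.m≤m+n n i))
          (solve 2 (λ c w → c :- w := con 0ℚ :- (w :- c)) refl c (w (n ℕ.+ i))))))))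
  half : ∀ {s} → s + s ℚ.≤ 1ℚ → s ℚ.≤ ½
  half {s} le = ≤-by (solve 1 (λ s → con ½ :* (s :+ s) := s) refl s) refl
    (ℚₚ.*-monoˡ-≤-nonNeg ½ le)

-- The minimal distances

-- At a fixed stage `t` of the approximating sequences a minimum of reals is a minimum of rationals,
-- so these bounds are exact, without an ε.
module _ {A : Set} (f : A → ℝ) (t : ℕ) where

  minimum-≤-init : ∀ b as → seq (foldr _⊓ᴿ_ b (map f as)) t ℚ.≤ seq b t
  minimum-≤-init b []       = ℚₚ.≤-refl
  minimum-≤-init b (a ∷ as) = ℚₚ.≤-trans (ℚₚ.p⊓q≤q (seq (f a) t) _) (minimum-≤-init b as)

  minimum-≤ : ∀ b {a as} → a ∈ as → seq (foldr _⊓ᴿ_ b (map f as)) t ℚ.≤ seq (f a) t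
  minimum-≤ b {a} (here refl) = ℚₚ.p⊓q≤p (seq (f a) t) _
  minimum-≤ b {as = a′ ∷ as} (there a∈as) =
    ℚₚ.≤-trans (ℚₚ.p⊓q≤q (seq (f a′) t) _) (minimum-≤ b a∈as)

  minimum-glb : ∀ {v} b as → v ℚ.≤ seq b t → (∀ {a} → a ∈ as → v ℚ.≤ seq (f a) t) →
    v ℚ.≤ seq (foldr _⊓ᴿ_ b (map f as)) t
  minimum-glb b []       v≤b _  = v≤b
  minimum-glb b (a ∷ as) v≤b v≤ = ℚₚ.⊓-glb (v≤ (here refl)) (minimum-glb b as v≤b (λ a∈ → v≤ (there a∈)))

∈-pairs⁺ : ∀ {r s n} → r ℕ.< s → s ℕ.< n → (suc r , suc s) ∈ pairs n
∈-pairs⁺ {r} {s} r<s s<n = ∈-concatMap⁺ _ (lose (∈-applyUpTo⁺ suc s<n) (∈-map⁺ (_, suc s) (∈-applyUpTo⁺ suc r<s)))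

pairs-elim : ∀ n (P : ℕ × ℕ → Set) → (∀ r s → r ℕ.< s → s ℕ.< n → P (suc r , suc s)) →
  ∀ {a} → a ∈ pairs n → P a
pairs-elim n P p a∈ with find (∈-concatMap⁻ (λ s → map (_, s) (range (s ∸ 1))) {xs = range n} a∈)
... | _ , s∈ , a∈s with ∈-applyUpTo⁻ suc s∈ | ∈-map⁻ _ a∈s
... | s , s<n , refl | _ , r∈ , refl with ∈-applyUpTo⁻ suc r∈
... | r , r<s , refl = p r s r<s s<n

pairDist : (ℕ → ℝ) → ℕ × ℕ → ℝ
pairDist x (r , s) = ρ (x r) (x s)

d-≤-pair : ∀ x t {r s n} → r ℕ.< s → s ℕ.< n →
  seq (d x n) t ℚ.≤ seq (ρ (x (suc r)) (x (suc s))) t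
d-≤-pair x t r<s s<n = minimum-≤ (pairDist x) t (ρ (x 1) (x 2)) (∈-pairs⁺ r<s s<n)

d-anti : ∀ x t {m n} → m ≤ n → seq (d x n) t ℚ.≤ seq (d x m) t
d-anti x t {m} {n} m≤n = minimum-glb (pairDist x) t (ρ (x 1) (x 2)) (pairs m)
  -- Both folds start from the same value, which settles also the case `m < 2`, where `pairs m` is
  -- empty.
  (minimum-≤-init (pairDist x) t (ρ (x 1) (x 2)) (pairs n))
  (pairs-elim m (λ a → seq (d x n) t ℚ.≤ seq (pairDist x a) t)
    λ r s r<s s<m → d-≤-pair x t {r} {s} {n} r<s (ℕₚ.<-≤-trans s<m m≤n))

-- The stage-`t` approximations of the points are themselves a configuration on the circle, so the
-- rational packing bound applies at every stage.
sum-d-≤-½ : ∀ x t {n} → 1 ≤ n → sumℚ n (λ i → seq (d x (suc (n ℕ.+ i))) t) ℚ.≤ ½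
sum-d-≤-½ x t = antitone-packing (λ i → seq (d x (suc i)) t) (λ i → seq (x (suc i)) t)
  (λ {i} {j} i≤j → d-anti x t {suc i} {suc j} (ℕ.s≤s i≤j))
  (λ {i} {j} i<j → d-≤-pair x t {i} {j} {suc j} i<j (ℕₚ.n<1+n j))

-- The logarithm

-- With mesh 1 / N the left Riemann sums of ∫₁^y dt/t are segments of the harmonic
-- series, and segments can be concatenated.
riemann-harmonic : ∀ {N m} → 1 ≤ N → 1 ≤ m →
  riemann (fromℕ (suc m)) (N ℕ.* m) ≡ sumℚ (N ℕ.* m) (λ j → recip (fromℕ (N ℕ.+ j)))
riemann-harmonic {N} {m} 1≤N 1≤m = sumℚ-cong (N ℕ.* m) term
  where
  h : ℚ
  h = step (fromℕ (suc m)) (N ℕ.* m)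
  N*h : fromℕ N * h ≡ 1ℚ
  N*h = trans
    (cong (λ z → fromℕ N * ((z - 1ℚ) * recip (fromℕ (N ℕ.* m)))) (fromℕ-suc m))
    (trans (solve 3 (λ n m r → n :* (((con 1ℚ :+ m) :- con 1ℚ) :* r) := (n :* m) :* r) refl
        (fromℕ N) (fromℕ m) (recip (fromℕ (N ℕ.* m))))
      (trans (cong (_* recip (fromℕ (N ℕ.* m))) (sym (fromℕ-* N m))) (N*recipN (ℕₚ.*-mono-≤ 1≤N 1≤m))))
  h≡ : h ≡ recip (fromℕ N)
  h≡ = recip-unique (0<fromℕ 1≤N) N*h
  term : ∀ j → h * recip (1ℚ + fromℕ j * h) ≡ recip (fromℕ (N ℕ.+ j))
  term j = recip-unique (0<fromℕ (ℕₚ.≤-trans 1≤N (ℕₚ.m≤m+n N j)))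
    (trans (cong (λ z → z * (h * recip (1ℚ + fromℕ j * h))) (fromℕ-+ N j))
    (trans (solve 4 (λ n j h r → (n :+ j) :* (h :* r) := (n :* h :+ j :* h) :* r) refl
        (fromℕ N) (fromℕ j) h (recip (1ℚ + fromℕ j * h)))
    (trans (cong (λ z → (z + fromℕ j * h) * recip (1ℚ + fromℕ j * h)) N*h)
      (recip-inverseʳ (ℚₚ.<-≤-trans 0<1 (p≤p+q 1ℚ (0≤* (0≤fromℕ j)
        (subst (0ℚ ℚ.≤_) (sym h≡) (0≤recip (0<fromℕ 1≤N))))))))))

-- This is ln 2n = ln n + ln 2 for `n = suc m`, exact on suitable meshes: the harmonic segment from
-- `N` to `2nN` is cut at `nN`, and its second half is a Riemann sum for ln 2 with mesh `1 / nN`.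
riemann-double : ∀ {N m} → 1 ≤ N → 1 ≤ m →
  riemann (fromℕ (suc m ℕ.+ suc m)) (N ℕ.* (m ℕ.+ suc m)) ≡
    riemann (fromℕ (suc m)) (N ℕ.* m) + riemann (fromℕ 2) (N ℕ.* suc m)
riemann-double {N} {m} 1≤N 1≤m = trans
  (riemann-harmonic 1≤N (ℕₚ.≤-trans 1≤m (ℕₚ.m≤m+n m (suc m))))
  (trans (cong (λ k → sumℚ k f) (ℕₚ.*-distribˡ-+ N m (suc m)))
  (trans (sumℚ-+ (N ℕ.* m) (N ℕ.* suc m) f)
    (cong₂ _+_ (sym (riemann-harmonic 1≤N 1≤m)) (trans
      (sumℚ-cong (N ℕ.* suc m) λ j → cong (λ k → recip (fromℕ k))
        (trans (sym (ℕₚ.+-assoc N (N ℕ.* m) j)) (cong (ℕ._+ j) (sym (ℕₚ.*-suc N m)))))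
      (trans (cong (λ k → sumℚ k g) (sym (ℕₚ.*-identityʳ (N ℕ.* suc m))))
        (trans (sym (riemann-harmonic (ℕₚ.*-mono-≤ 1≤N (ℕ.s≤s ℕ.z≤n)) (ℕ.s≤s ℕ.z≤n)))
          (cong (riemann (fromℕ 2)) (ℕₚ.*-identityʳ (N ℕ.* suc m)))))))))
  where
  f g : ℕ → ℚ
  f j = recip (fromℕ (N ℕ.+ j))
  g j = recip (fromℕ (N ℕ.* suc m ℕ.+ j))

-- The constant of `riemann-refine` for `δ = 1`, that is, the square of `y - 1`.
meshError : ℕ → ℚ
meshError y = ∣ fromℕ y - 1ℚ ∣ * ∣ fromℕ y - 1ℚ ∣ * (recip 1ℚ * recip 1ℚ)

0≤meshError : ∀ y → 0ℚ ℚ.≤ meshError y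
0≤meshError y = 0≤* (0≤* (ℚₚ.0≤∣p∣ (fromℕ y - 1ℚ)) (ℚₚ.0≤∣p∣ (fromℕ y - 1ℚ))) (0≤* (0≤recip 0<1) (0≤recip 0<1))

riemann-mesh : ∀ y N M → 1 ≤ y → 1 ≤ N → 1 ≤ M →
  ∣ riemann (fromℕ y) N - riemann (fromℕ y) (N ℕ.* M) ∣ ℚ.≤ meshError y * recip (fromℕ N)
riemann-mesh y N M 1≤y 1≤N 1≤M =
  riemann-refine {1ℚ} {fromℕ y} {N} {M} 0<1 ℚₚ.≤-refl (1≤fromℕ 1≤y) 1≤N 1≤M

-- The three sums with `N` steps are refined by the factors `n`, `m` and `m + suc m`, where
-- `riemann-double` is exact. Each refinement costs a constant over `N`, and `C` collects the three
-- constants.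
ln2+lnn≤ln2n : ∀ n → 2 ≤ n → ∀ ε → 0ℚ ℚ.< ε → Eventually λ t →
  riemann (fromℕ 2) (suc t) ℚ.≤
    (riemann (fromℕ (n ℕ.+ n)) (suc t) - riemann (fromℕ n) (suc t)) + ε
ln2+lnn≤ln2n n@(suc m) (ℕ.s≤s 1≤m) ε 0<ε =
  let T , small = small-* {λ s _ → recip (fromℕ (suc s))} C 0≤C
        (λ η 0<η → let K , p = archimedean η 0<η in K , λ s _ s≥ _ → p s s≥) ε 0<ε
  in T , λ t t≥ → bound (suc t) (ℕ.s≤s ℕ.z≤n) (small t t t≥ t≥)
  where
  C : ℚ
  C = (meshError 2 + meshError n) + meshError (n ℕ.+ n)
  0≤C : 0ℚ ℚ.≤ C
  0≤C = 0≤+ (0≤+ (0≤meshError 2) (0≤meshError n)) (0≤meshError (n ℕ.+ n))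
  R : ℕ → ℕ → ℚ
  R y N = riemann (fromℕ y) N
  bound : ∀ N → 1 ≤ N → C * recip (fromℕ N) ℚ.≤ ε → R 2 N ℚ.≤ (R (n ℕ.+ n) N - R n N) + ε
  bound N 1≤N small = combine
    (R 2 N) (R n N) (R (n ℕ.+ n) N) (R 2 (N ℕ.* n)) (R n (N ℕ.* m)) (R (n ℕ.+ n) (N ℕ.* (m ℕ.+ suc m)))
    (meshError 2) (meshError n) (meshError (n ℕ.+ n)) (recip (fromℕ N))
    (riemann-double 1≤N 1≤m)
    (near 2 n (ℕ.s≤s ℕ.z≤n) (ℕ.s≤s ℕ.z≤n)) (near n m (ℕ.s≤s ℕ.z≤n) 1≤m)
    (far (n ℕ.+ n) (m ℕ.+ suc m) (ℕ.s≤s ℕ.z≤n) (ℕₚ.≤-trans 1≤m (ℕₚ.m≤m+n m (suc m))))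
    small
    where
    near : ∀ y M → 1 ≤ y → 1 ≤ M → R y N ℚ.≤ R y (N ℕ.* M) + meshError y * recip (fromℕ N)
    near y M 1≤y 1≤M = ℚₚ.≤-trans (p≤q+∣p-q∣ (R y N) (R y (N ℕ.* M)))
      (ℚₚ.+-monoʳ-≤ (R y (N ℕ.* M)) (riemann-mesh y N M 1≤y 1≤N 1≤M))
    far : ∀ y M → 1 ≤ y → 1 ≤ M → R y (N ℕ.* M) ℚ.≤ R y N + meshError y * recip (fromℕ N)
    far y M 1≤y 1≤M = ℚₚ.≤-trans (p≤q+∣p-q∣ (R y (N ℕ.* M)) (R y N))
      (ℚₚ.+-monoʳ-≤ (R y N) (≤-by (∣-∣-sym (R y N) (R y (N ℕ.* M))) refl (riemann-mesh y N M 1≤y 1≤N 1≤M)))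
    combine : ∀ a b c a′ b′ c′ u v w r → c′ ≡ b′ + a′ →
      a ℚ.≤ a′ + u * r → b ℚ.≤ b′ + v * r → c′ ℚ.≤ c + w * r →
      ((u + v) + w) * r ℚ.≤ ε → a ℚ.≤ (c - b) + ε
    combine a b c a′ b′ c′ u v w r eq a≤ b≤ c≤ small = ≤-by-diff
      (ℚₚ.+-mono-≤ (ℚₚ.+-mono-≤ (ℚₚ.+-mono-≤ a≤ b≤) (≤-by eq refl c≤)) small)
      (solve 10 (λ a b c a′ b′ u v w r e →
          ((((a′ :+ u :* r) :+ (b′ :+ v :* r)) :+ (c :+ w :* r)) :+ e)
            :- (((a :+ b) :+ (b′ :+ a′)) :+ ((u :+ v) :+ w) :* r)
          := ((c :- b) :+ e) :- a)
        refl a b c a′ b′ u v w r ε)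

-- Here `a` stands for ln 2 and `b` for ln 2n - ln n. Since `2a ≥ 1`, division by `2a` does not
-- enlarge the error `ε`.
½-≤-scaled : ∀ a b {ε} → 0ℚ ℚ.< ε → recip (fromℕ 2) ℚ.≤ a → a ℚ.≤ b + ε →
  ½ ℚ.≤ b * recip (fromℕ 2 * a) + ε
½-≤-scaled a b {ε} 0<ε ½≤a a≤b+ε = ℚₚ.≤-trans
  (≤-by a*r refl (ℚₚ.*-monoʳ-≤-nonNeg r {{ℚ.nonNegative 0≤r}} a≤b+ε))
  (≤-by (sym (ℚₚ.*-distribʳ-+ r b ε)) refl (ℚₚ.+-monoʳ-≤ (b * r)
    (≤-by refl (ℚₚ.*-identityʳ ε) (ℚₚ.*-monoˡ-≤-nonNeg ε {{ℚ.nonNegative (ℚₚ.<⇒≤ 0<ε)}} r≤1))))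
  where
  r : ℚ
  r = recip (fromℕ 2 * a)
  1≤2a : 1ℚ ℚ.≤ fromℕ 2 * a
  1≤2a = ≤-by (N*recipN (ℕ.s≤s ℕ.z≤n)) refl
    (ℚₚ.*-monoˡ-≤-nonNeg (fromℕ 2) {{ℚ.nonNegative (0≤fromℕ 2)}} ½≤a)
  0<2a : 0ℚ ℚ.< fromℕ 2 * a
  0<2a = ℚₚ.<-≤-trans 0<1 1≤2a
  0≤r : 0ℚ ℚ.≤ r
  0≤r = 0≤recip 0<2a
  r≤1 : r ℚ.≤ 1ℚ
  r≤1 = ≤-by refl (sym (recip-unique 0<1 (ℚₚ.*-identityˡ 1ℚ))) (recip-anti 0<1 1≤2a)
  2≡ : fromℕ 2 ≡ 1ℚ + 1ℚ
  2≡ = trans (fromℕ-suc 1) (cong (_+_ 1ℚ) fromℕ-1)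
  a*r : a * r ≡ ½
  a*r = trans (solve 2 (λ a r → a :* r := con ½ :* (((con 1ℚ :+ con 1ℚ) :* a) :* r)) refl a r)
    (trans (cong (λ z → ½ * ((z * a) * r)) (sym 2≡))
      (trans (cong (½ *_) (recip-inverseʳ 0<2a)) (ℚₚ.*-identityʳ ½)))

-- At one stage all terms share the same approximation of 2 ln 2 as denominator, so the sum
-- telescopes exactly.
sum-φ : ∀ n (p : ∀ i → 1 ≤ n ℕ.+ i) t →
  sumℚ n (λ i → seq (φ (n ℕ.+ i) (p i)) t) ≡
    (riemann (fromℕ (n ℕ.+ n)) (suc t) - riemann (fromℕ n) (suc t)) *
      recip (fromℕ 2 * riemann (fromℕ 2) (suc t))
sum-φ n p t = trans
  (sumℚ-cong n λ i → cong (λ k → (R k - R (n ℕ.+ i)) * r)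
    (trans (ℕₚ.+-assoc n i 1) (cong (n ℕ.+_) (ℕₚ.+-comm i 1))))
  (trans (sumℚ-telescope n (λ i → R (n ℕ.+ i)) r)
    (cong (λ k → (R (n ℕ.+ n) - R k) * r) (ℕₚ.+-identityʳ n)))
  where
  R : ℕ → ℚ
  R k = riemann (fromℕ k) (suc t)
  r : ℚ
  r = recip (fromℕ 2 * R 2)

½-≤-sum-φ : ∀ n → 2 ≤ n → (p : ∀ i → 1 ≤ n ℕ.+ i) → ∀ ε → 0ℚ ℚ.< ε →
  Eventually λ t → ½ ℚ.≤ sumℚ n (λ i → seq (φ (n ℕ.+ i) (p i)) t) + ε
½-≤-sum-φ n 2≤n p ε 0<ε =
  let T , close = ln2+lnn≤ln2n n 2≤n ε 0<ε
  in T , λ t t≥ → ≤-by refl (cong (_+ ε) (sym (sum-φ n p t)))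
       (½-≤-scaled (riemann (fromℕ 2) (suc t)) (riemann (fromℕ (n ℕ.+ n)) (suc t) - riemann (fromℕ n) (suc t))
         -- The projections extract the lower bound `recip (fromℕ 2)` for ln 2, valid from stage 0
         -- on.
         0<ε (proj₂ (proj₂ (proj₂ ln2-positive)) t ℕ.z≤n) (close t t≥))

-- The comparison of sums of real numbers

-- The strict inequality `b < a` in positive form: one `ε` serves all late stages, so gaps can be
-- added.
Gap : (ℕ → ℚ) → (ℕ → ℚ) → Set
Gap a b = ∃[ ε ] (0ℚ ℚ.< ε × Eventually λ t → b t + ε ℚ.≤ a t)

gap-+ : ∀ {a b a′ b′} → Gap a b → Gap a′ b′ → Gap (λ t → a t + a′ t) (λ t → b t + b′ t)
gap-+ {a} {b} {a′} {b′} (ε , 0<ε , le) (ε′ , 0<ε′ , le′) = ε + ε′ , ℚₚ.+-mono-< 0<ε 0<ε′ ,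
  both (λ {t} p q → ≤-by
    (solve 4 (λ b b′ e e′ → (b :+ e) :+ (b′ :+ e′) := (b :+ b′) :+ (e :+ e′)) refl (b t) (b′ t) ε ε′)
    refl (ℚₚ.+-mono-≤ p q)) le le′

-- An excess of more than `ε` at one late stage would persist as a gap of `ε / 2`, because each
-- Cauchy sequence moves by at most `ε / 4` afterwards. Excluded middle decides whether there is a
-- gap.
≤ᴿ-or-gap : ExcludedMiddle 0ℓ → ∀ a b → a ≤ᴿ b ⊎ Gap (seq a) (seq b)
≤ᴿ-or-gap em a b with em {P = Gap (seq a) (seq b)}
... | yes gap = inj₂ gap
... | no ¬gap = inj₁ λ ε 0<ε →
  let δ = ½ * (½ * ε)
      0<δ = 0<½* {½ * ε} (0<½* 0<ε)
      T , closeᵃ = cauchy a δ 0<δ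
      T′ , closeᵇ = cauchy b δ 0<δ
      ≥T = λ {t} → ℕₚ.≤-trans {T} {T ℕ.⊔ T′} {t} (ℕₚ.m≤m⊔n T T′)
      ≥T′ = λ {t} → ℕₚ.≤-trans {T′} {T ℕ.⊔ T′} {t} (ℕₚ.m≤n⊔m T T′)
  in T ℕ.⊔ T′ , λ t t≥ → ℚₚ.≮⇒≥ λ b+ε<a → ¬gap (½ * ε , 0<½* 0<ε , T ℕ.⊔ T′ , λ u u≥ →
    spread (seq a t) (seq b t) (seq a u) (seq b u) ε (ℚₚ.<⇒≤ b+ε<a)
      (closeᵃ t u (≥T t≥) (≥T u≥)) (closeᵇ u t (≥T′ u≥) (≥T′ t≥)))
  where
  spread : ∀ a b a′ b′ ε → b + ε ℚ.≤ a → ∣ a - a′ ∣ ℚ.≤ ½ * (½ * ε) → ∣ b′ - b ∣ ℚ.≤ ½ * (½ * ε) →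
    b′ + ½ * ε ℚ.≤ a′
  spread a b a′ b′ ε b+ε≤a closeᵃ closeᵇ = ≤-by-diff
    (ℚₚ.+-mono-≤ b+ε≤a (ℚₚ.+-mono-≤
      (ℚₚ.≤-trans (p≤∣p∣ (a - a′)) closeᵃ) (ℚₚ.≤-trans (p≤∣p∣ (b′ - b)) closeᵇ)))
    (solve 5 (λ a b a′ b′ e →
        (a :+ (con ½ :* (con ½ :* e) :+ con ½ :* (con ½ :* e))) :- ((b :+ e) :+ ((a :- a′) :+ (b′ :- b)))
      := a′ :- (b′ :+ con ½ :* e))
      refl a b a′ b′ ε)

partialSum : ℕ → (ℕ → ℝ) → ℕ → ℚ
partialSum n a t = sumℚ n (λ i → seq (a i) t)

-- Either some comparison holds, or all the termwise gaps add up. The sums have `suc n` terms, as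
-- empty sums have no gap.
≤ᴿ-or-gap-sum : ExcludedMiddle 0ℓ → ∀ n (a b : ℕ → ℝ) →
  (∃[ i ] a i ≤ᴿ b i) ⊎ Gap (partialSum (suc n) a) (partialSum (suc n) b)
≤ᴿ-or-gap-sum em n a b with ≤ᴿ-or-gap em (a 0) (b 0)
... | inj₁ le = inj₁ (0 , le)
≤ᴿ-or-gap-sum em zero a b | inj₂ (ε , 0<ε , T , gap) = inj₂ (ε , 0<ε , T , λ t t≥ →
  ≤-by (cong (_+ ε) (sym (ℚₚ.+-identityʳ (seq (b 0) t)))) (sym (ℚₚ.+-identityʳ (seq (a 0) t))) (gap t t≥))
≤ᴿ-or-gap-sum em (suc n) a b | inj₂ gap
  with ≤ᴿ-or-gap-sum em n (λ i → a (suc i)) (λ i → b (suc i))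
... | inj₁ (i , le) = inj₁ (suc i , le)
... | inj₂ gaps     = inj₂ (gap-+ {seq (a 0)} {seq (b 0)} gap gaps)

no-gap : ∀ a b → (∀ ε → 0ℚ ℚ.< ε → Eventually λ t → a t ℚ.≤ b t + ε) → ¬ Gap a b
no-gap a b le (ε , 0<ε , T , gap) =
  let S , close = le (½ * ε) (0<½* 0<ε)
      t = S ℕ.⊔ T
  in ℚₚ.<-irrefl refl (ℚₚ.<-≤-trans (0<½* 0<ε) (≤-by-diff
    (ℚₚ.≤-trans (gap t (ℕₚ.m≤n⊔m S T)) (close t (ℕₚ.m≤m⊔n S T)))
    (solve 2 (λ b e → (b :+ con ½ :* e) :- (b :+ e) := con 0ℚ :- con ½ :* e) refl (b t) ε)))

sum-≤⇒∃-≤ : ExcludedMiddle 0ℓ → ∀ n (a b : ℕ → ℝ) →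
  (∀ ε → 0ℚ ℚ.< ε → Eventually λ t → partialSum (suc n) a t ℚ.≤ partialSum (suc n) b t + ε) →
  ∃[ i ] a i ≤ᴿ b i
sum-≤⇒∃-≤ em n a b le with ≤ᴿ-or-gap-sum em n a b
... | inj₁ found = found
... | inj₂ gap   = contradiction gap (no-gap (partialSum (suc n) a) (partialSum (suc n) b) le)

-- An index beyond any given bound.

theorem2 : ExcludedMiddle 0ℓ → (x : ℕ → Setoid.Carrier 𝕋) →
    ∀ N → ∃[ n ] Σ[ 2≤n ∈ 2 ≤ n ] (N ≤ n × d x n ≤ᴿ φ (n ∸ 1) (∸-monoˡ-≤ 1 2≤n))
theorem2 em x N =
  -- The argument `suc N` stands for `n = suc (suc N)` summands; the term `i` compares `d` at
  -- `suc (n + i)` with `φ` at `n + i`.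
  let i , le = sum-≤⇒∃-≤ em (suc N) (λ i → d x (suc (n ℕ.+ i))) (λ i → φ (n ℕ.+ i) (∸-monoˡ-≤ 1 (2≤ i)))
        λ ε 0<ε → let T , p = ½-≤-sum-φ n (ℕ.s≤s (ℕ.s≤s ℕ.z≤n)) (λ i → ∸-monoˡ-≤ 1 (2≤ i)) ε 0<ε
          in T , λ t t≥ → ℚₚ.≤-trans (sum-d-≤-½ x t {n} (ℕ.s≤s ℕ.z≤n)) (p t t≥)
  in suc (n ℕ.+ i) , 2≤ i , ℕₚ.≤-trans (ℕₚ.m≤n+m N 3) (ℕ.s≤s (ℕₚ.m≤m+n n i)) , le
  where
  n : ℕ
  -- Large enough for `½-≤-sum-φ`, which asks for `2 ≤ n`, and for every index of the block to
  -- exceed `N`.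
  n = suc (suc N)
  2≤ : ∀ i → 2 ≤ suc (n ℕ.+ i)
  2≤ i = ℕ.s≤s (ℕ.s≤s ℕ.z≤n)
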